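{- As $n\to\infty$: (a) $H_n(C_6)\le n^{\frac{2}{3}n+o(n)}$; (b) $H_n(C_8)\le n^{\frac{4}{5}n+o(n)}$; (c) $H_n(C_{10})\le n^{\frac{4}{5}n+o(n)}$.
   Context: For a graph $G$, $H_n(G)$ denotes the maximum number of Hamilton paths in the complete graph $K_n$ such that the union of any two of them contains $G$ as a subgraph. $C_m$ denotes the cycle of length $m$. -}

module Defs where

open import Data.Empty using (⊥-elim)
open import Data.Fin as Fin using (Fin; toℕ; finToFun; funToFin)
open import Data.Fin.Properties using (any?; all?; finToFun-funToFin; injective⇒≤)
open import Data.Integer as ℤ using (ℤ)
open import Data.Nat as ℕ using (ℕ; zero; suc; _≤_; _≥_; s≤s)
import Data.Nat.Properties as ℕₚ
open import Data.Product using (Σ; Σ-syntax; ∃; ∃-syntax; _×_; _,_; proj₁; proj₂)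
open import Data.Rational as ℚ using (ℚ; 0ℚ; ↥_; ↧ₙ_)
open import Data.Sum as Sum using (_⊎_; inj₁; inj₂)
open import Function.Base using (_∘_)
open import Function.Bundles using (_⇔_; mk⇔; module Equivalence)
open import Function.Definitions using (Injective)
open import Level using (0ℓ)
open import Relation.Binary.Core using (Rel)
open import Relation.Binary.Definitions as Binary using (Symmetric)
open import Relation.Binary.PropositionalEquality
  using (_≡_; _≢_; _≗_; refl; sym; trans; cong; subst; subst₂; ≢-sym)
open import Relation.Nullary using (¬_; Dec; yes; no; ¬?)
open import Relation.Nullary.Decidable using (True; toWitness; map′; _×-dec_; _⊎-dec_; _→-dec_)
open import Relation.Unary using (Decidable)

private
  variable
    m n : ℕ

record Graph (n : ℕ) : Set₁ where
  field
    Adj    : Rel (Fin n) 0ℓ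
    symm   : Symmetric Adj
    irrefl : ∀ {i} → ¬ Adj i i
    adj?   : Binary.Decidable Adj

open Graph public

K : (n : ℕ) → Graph n
K n = record
  { Adj    = _≢_
  ; symm   = ≢-sym
  ; irrefl = λ i≢i → i≢i refl
  ; adj?   = λ i j → ¬? (i Fin.≟ j)
  }

PathStep : Rel (Fin n) 0ℓ
PathStep i j = suc (toℕ i) ≡ toℕ j

P : (n : ℕ) → Graph n
P n = record
  { Adj    = λ i j → PathStep i j ⊎ PathStep j i
  ; symm   = Sum.swap
  ; irrefl = Sum.[ ℕₚ.1+n≢n , ℕₚ.1+n≢n ]
  ; adj?   = λ i j → (suc (toℕ i) ℕ.≟ toℕ j) ⊎-dec (suc (toℕ j) ℕ.≟ toℕ i)
  }

CycleStep : Rel (Fin m) 0ℓ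
CycleStep {m} i j = PathStep i j ⊎ (suc (toℕ i) ≡ m × toℕ j ≡ 0)

private
  cycleStep? : Binary.Decidable (CycleStep {m})
  cycleStep? {m} i j =
    (suc (toℕ i) ℕ.≟ toℕ j) ⊎-dec ((suc (toℕ i) ℕ.≟ m) ×-dec (toℕ j ℕ.≟ 0))

  cycleStep-irrefl : 3 ≤ m → {i : Fin m} → ¬ CycleStep i i
  cycleStep-irrefl 3≤m (inj₁ eq)        = ℕₚ.1+n≢n eq
  cycleStep-irrefl 3≤m (inj₂ (eq , i≡0))
    with s≤s () ← subst (3 ≤_) (trans (sym eq) (cong suc i≡0)) 3≤m

C : (m : ℕ) {3≤m : True (3 ℕ.≤? m)} → Graph m
C m {3≤m} = record
  { Adj    = λ i j → CycleStep i j ⊎ CycleStep j i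
  ; symm   = Sum.swap
  ; irrefl = Sum.[ cycleStep-irrefl (toWitness 3≤m) , cycleStep-irrefl (toWitness 3≤m) ]
  ; adj?   = λ i j → cycleStep? i j ⊎-dec cycleStep? j i
  }

infixr 6 _∪_
_∪_ : Graph n → Graph n → Graph n
G ∪ F = record
  { Adj    = λ i j → Adj G i j ⊎ Adj F i j
  ; symm   = Sum.map (symm G) (symm F)
  ; irrefl = Sum.[ irrefl G , irrefl F ]
  ; adj?   = λ i j → adj? G i j ⊎-dec adj? F i j
  }

infix 4 _≈_
_≈_ : Graph n → Graph n → Set
G ≈ F = ∀ i j → Adj G i j ⇔ Adj F i j

-- G ↪ F is inhabited iff F contains G as a (not necessarily induced) subgraph.

infix 4 _↪_
record _↪_ (G : Graph m) (F : Graph n) : Set where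
  field
    to        : Fin m → Fin n
    injective : Injective _≡_ _≡_ to
    preserves : ∀ {i j} → Adj G i j → Adj F (to i) (to j)

open _↪_ public

image : {G : Graph m} {F : Graph n} → G ↪ F → Graph n
image {m} {n} {G} f = record
  { Adj    = λ u v → ∃[ i ] ∃[ j ] Adj G i j × to f i ≡ u × to f j ≡ v
  ; symm   = λ (i , j , a , p , q) → j , i , symm G a , q , p
  ; irrefl = λ (i , j , a , p , q) →
               irrefl G (subst (Adj G i) (injective f (trans q (sym p))) a)
  ; adj?   = λ u v → any? λ i → any? λ j →
               adj? G i j ×-dec (to f i Fin.≟ u) ×-dec (to f j Fin.≟ v)
  }

-- A traversal of a Hamilton path. A path and its reversal are the same
-- Hamilton path, so paths are compared through the graphs they trace.

HamiltonPath : Graph n → Set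
HamiltonPath {n} F = P n ↪ F

Family : (n : ℕ) → Graph m → ℕ → Set
Family n G k =
  Σ[ p ∈ (Fin k → HamiltonPath (K n)) ]
    (∀ i j → i ≢ j → ¬ (image (p i) ≈ image (p j)) × G ↪ (image (p i) ∪ image (p j)))

IsMaximum : (ℕ → Set) → ℕ → Set
IsMaximum Q k = Q k × (∀ j → Q j → j ≤ k)

-- The maximum is obtained by exhaustive search: being the size of a family is
-- decidable, 0 is such a size, and every such size is at most n ^ n.

private
  any-fun? : {Q : (Fin m → Fin n) → Set} →
             (∀ {f g} → f ≗ g → Q f → Q g) → Decidable Q → Dec (∃ Q)
  any-fun? resp Q? =
    map′ (λ (c , q) → finToFun c , q)
         (λ (f , q) → funToFin f , resp (sym ∘ finToFun-funToFin f) q)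
         (any? (Q? ∘ finToFun))

  IsEmbedding : Graph m → Graph n → (Fin m → Fin n) → Set
  IsEmbedding G F f =
    (∀ i j → f i ≡ f j → i ≡ j) × (∀ i j → Adj G i j → Adj F (f i) (f j))

  isEmbedding? : (G : Graph m) (F : Graph n) → Decidable (IsEmbedding G F)
  isEmbedding? G F f =
    (all? λ i → all? λ j → (f i Fin.≟ f j) →-dec (i Fin.≟ j)) ×-dec
    (all? λ i → all? λ j → adj? G i j →-dec adj? F (f i) (f j))

  isEmbedding-resp : (G : Graph m) (F : Graph n) {f g : Fin m → Fin n} →
                     f ≗ g → IsEmbedding G F f → IsEmbedding G F g
  isEmbedding-resp G F f≗g (inj , pres) =
    (λ i j eq → inj i j (trans (f≗g i) (trans eq (sym (f≗g j))))) ,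
    (λ i j a → subst₂ (Adj F) (f≗g i) (f≗g j) (pres i j a))

  fromMap : (G : Graph m) (F : Graph n) (f : Fin m → Fin n) → IsEmbedding G F f → G ↪ F
  fromMap G F f (inj , pres) = record
    { to        = f
    ; injective = inj _ _
    ; preserves = pres _ _
    }

  isEmbedding : {G : Graph m} {F : Graph n} (f : G ↪ F) → IsEmbedding G F (to f)
  isEmbedding f = (λ _ _ → injective f) , (λ _ _ → preserves f)

  embeds? : (G : Graph m) (F : Graph n) → Dec (G ↪ F)
  embeds? G F =
    map′ (λ (f , e) → fromMap G F f e) (λ f → to f , isEmbedding f)
         (any-fun? (isEmbedding-resp G F) (isEmbedding? G F))

  _≈?_ : (G F : Graph n) → Dec (G ≈ F)
  G ≈? F =
    map′ (λ h i j → mk⇔ (proj₁ (h i j)) (proj₂ (h i j)))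
         (λ h i j → Equivalence.to (h i j) , Equivalence.from (h i j))
         (all? λ i → all? λ j →
           (adj? G i j →-dec adj? F i j) ×-dec (adj? F i j →-dec adj? G i j))

  image-mono : {G : Graph m} {F : Graph n} {f g : G ↪ F} → to f ≗ to g →
               ∀ {u v} → Adj (image f) u v → Adj (image g) u v
  image-mono f≗g (i , j , a , p , q) =
    i , j , a , trans (sym (f≗g i)) p , trans (sym (f≗g j)) q

  Compatible : Graph m → Rel (HamiltonPath (K n)) 0ℓ
  Compatible G p q = ¬ (image p ≈ image q) × G ↪ (image p ∪ image q)

  compatible? : (G : Graph m) → Binary.Decidable (Compatible {n = n} G)
  compatible? G p q = ¬? (image p ≈? image q) ×-dec embeds? G (image p ∪ image q)

  compatible-resp : (G : Graph m) {p p′ q q′ : HamiltonPath (K n)} →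
                    to p ≗ to p′ → to q ≗ to q′ → Compatible G p q → Compatible G p′ q′
  compatible-resp G {p} {p′} {q} {q′} p≗ q≗ (p≉q , f) =
    (λ p′≈q′ → p≉q λ i j → mk⇔
      (image-mono {f = q′} {q} (sym ∘ q≗) ∘ Equivalence.to (p′≈q′ i j)
        ∘ image-mono {f = p} {p′} p≗)
      (image-mono {f = p′} {p} (sym ∘ p≗) ∘ Equivalence.from (p′≈q′ i j)
        ∘ image-mono {f = q} {q′} q≗)) ,
    record
      { to        = to f
      ; injective = injective f
      ; preserves = Sum.map (image-mono {f = p} {p′} p≗) (image-mono {f = q} {q′} q≗)
                    ∘ preserves f
      }

  module _ (n : ℕ) (G : Graph m) (k : ℕ) where

    decode : Fin ((n ℕ.^ n) ℕ.^ k) → Fin k → Fin n → Fin n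
    decode c i = finToFun (finToFun c i)

    encode : (Fin k → Fin n → Fin n) → Fin ((n ℕ.^ n) ℕ.^ k)
    encode f = funToFin (funToFin ∘ f)

    decode-encode : ∀ f i → decode (encode f) i ≗ f i
    decode-encode f i j =
      trans (cong (λ c → finToFun c j) (finToFun-funToFin (funToFin ∘ f) i))
            (finToFun-funToFin (f i) j)

    path : (f : Fin n → Fin n) → IsEmbedding (P n) (K n) f → HamiltonPath (K n)
    path = fromMap (P n) (K n)

    IsFamily : (Fin k → Fin n → Fin n) → Set
    IsFamily f =
      Σ[ e ∈ (∀ i → IsEmbedding (P n) (K n) (f i)) ]
        (∀ i j → i ≢ j → Compatible G (path (f i) (e i)) (path (f j) (e j)))

    isFamily? : Decidable IsFamily
    isFamily? f with all? (λ i → isEmbedding? (P n) (K n) (f i))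
    ... | no ¬e = no (¬e ∘ proj₁)
    ... | yes e =
      map′ (e ,_)
           (λ (e′ , h) i j i≢j →
             compatible-resp G {path (f i) (e′ i)} {path (f i) (e i)}
                               {path (f j) (e′ j)} {path (f j) (e j)}
                               (λ _ → refl) (λ _ → refl) (h i j i≢j))
           (all? λ i → all? λ j →
             ¬? (i Fin.≟ j) →-dec compatible? G (path (f i) (e i)) (path (f j) (e j)))

    family? : Dec (Family n G k)
    family? = map′
      (λ (c , e , h) → (λ i → path (decode c i) (e i)) , h)
      (λ (p , h) →
        let f = to ∘ p
            ≗decode = λ i j → sym (decode-encode f i j)
            e = λ i → isEmbedding-resp (P n) (K n) (≗decode i) (isEmbedding (p i))
            p′ = λ i → path (decode (encode f) i) (e i)
        in  encode f , e ,
            (λ i j i≢j →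
              compatible-resp G {p i} {p′ i} {p j} {p′ j} (≗decode i) (≗decode j) (h i j i≢j)))
      (any? (isFamily? ∘ decode))

    family-bound : Family n G k → k ≤ n ℕ.^ n
    family-bound (p , h) = injective⇒≤ {f = funToFin ∘ to ∘ p} codes-injective
      where
      codes-injective : Injective _≡_ _≡_ (funToFin ∘ to ∘ p)
      codes-injective {i} {j} eq with i Fin.≟ j
      ... | yes i≡j = i≡j
      ... | no  i≢j = ⊥-elim (proj₁ (h i j i≢j) λ _ _ → mk⇔
              (image-mono {f = p i} {p j} pi≗pj) (image-mono {f = p j} {p i} (sym ∘ pi≗pj)))
        where
        pi≗pj : to (p i) ≗ to (p j)
        pi≗pj x = trans (sym (finToFun-funToFin (to (p i)) x))
                    (trans (cong (λ c → finToFun c x) eq) (finToFun-funToFin (to (p j)) x))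

  maximum-exists : {Q : ℕ → Set} → Decidable Q → Q 0 →
                   ∀ b → (∀ j → Q j → j ≤ b) → ∃ (IsMaximum Q)
  maximum-exists Q? q₀ zero    bound = 0 , q₀ , bound
  maximum-exists Q? q₀ (suc b) bound with Q? (suc b)
  ... | yes q = suc b , q , bound
  ... | no ¬q = maximum-exists Q? q₀ b λ j qj →
        ℕₚ.m<1+n⇒m≤n (ℕₚ.≤∧≢⇒< (bound j qj) λ { refl → ¬q qj })

  H-exists : (n : ℕ) (G : Graph m) → ∃ (IsMaximum (Family n G))
  H-exists n G =
    maximum-exists (family? n G) ((λ ()) , λ ()) (n ℕ.^ n) (family-bound n G)

H : (n : ℕ) → Graph m → ℕ
H n G = proj₁ (H-exists n G)

H-isMaximum : (n : ℕ) (G : Graph m) → IsMaximum (Family n G) (H n G)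
H-isMaximum n G = proj₂ (H-exists n G)

-- For q = p / d with d > 0 and b > 0, x ≤ b ^ q iff x ^ d ≤ b ^ p; when p < 0
-- the power of b is moved to the left-hand side.

infix 4 _≤_^_/_ _≤[_^_] _∈o[n] _≤n^[_n+o[n]]

_≤_^_/_ : ℕ → ℕ → ℤ → ℕ → Set
x ≤ b ^ ℤ.+ p      / d = x ℕ.^ d ℕ.≤ b ℕ.^ p
x ≤ b ^ ℤ.-[1+ p ] / d = x ℕ.^ d ℕ.* b ℕ.^ suc p ℕ.≤ 1

_≤[_^_] : ℕ → ℕ → ℚ → Set
x ≤[ b ^ q ] = x ≤ b ^ ↥ q / ↧ₙ q

fromℕ : ℕ → ℚ
fromℕ n = ℤ.+ n ℚ./ 1

_∈o[n] : (ℕ → ℚ) → Set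
f ∈o[n] = ∀ ε → 0ℚ ℚ.< ε → ∃[ N ] ∀ n → n ≥ N → ℚ.∣ f n ∣ ℚ.≤ ε ℚ.* fromℕ n

-- a n ≤ n ^ (c n + o(n)) as n → ∞. Rational-valued error terms lose nothing: a
-- real-valued one can be rounded up to an integer, which changes it by at most 1.

_≤n^[_n+o[n]] : (ℕ → ℕ) → ℚ → Set
a ≤n^[ c n+o[n]] =
  Σ[ f ∈ (ℕ → ℚ) ] f ∈o[n] ×
    (∃[ N ] ∀ n → n ≥ N → a n ≤[ n ^ c ℚ.* fromℕ n ℚ.+ f n ])

{-# OPTIONS --safe #-}

-- Let G be one of the three cycles, and let F be a G-free graph on n^(1+o(1))
-- vertices. A map from the n vertices to F embeds at most one path of a family,
-- since two embedded paths would carry a copy of G into F. There are n^(n+o(n))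
-- maps, so it suffices that every Hamilton path is embedded by r^(n-o(n)) of
-- them, where F has degree about r = |F|^(1/3), respectively |F|^(1/5); it is
-- not needed that F has a Hamilton path itself.
--
-- F consists of points (s , v) and lines (t , w) with s, t ∈ ℤ/p and v, w ∈ (ℤ/p)^κ,
-- a point and a line being adjacent iff v + w = f(s, t). A closed walk in F yields
-- linear relations between powers of the s, which Vandermonde's determinant
-- excludes for suitable monomials f. Primes p of the right size exist by
-- Chebyshev's argument.
--
-- A path is embedded chunk by chunk. A chunk is a walk of bounded length R through
-- disjoint sets of colours s and t, and is chosen greedily so as to avoid the
-- earlier chunks; almost all choices remain available. Consecutive chunks are
-- joined by paths of fresh vertices that are longer than G, hence irrelevant for
-- copies of G; which chunk ends they join is part of the counted data, at a cost
-- of n^O(n/R).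

module Submission where

open import Defs
open import Data.Bool.Base using (Bool; true; false; not; if_then_else_)
import Data.Bool.Properties as Bool
open import Data.Empty using (⊥)
open import Data.Fin.Base as Fin using
  ( Fin; zero; suc; toℕ; fromℕ<; inject≤; inject₁; punchIn; punchOut
  ; combine; remQuot; finToFun; funToFin; splitAt; join; _↑ʳ_)
open import Data.Fin.Induction using (<-weakInduction)
open import Data.Fin.Patterns using (0F; 1F; 2F; 3F; 4F)
import Data.Fin.Properties as Fin
open import Data.Integer using (+_)
open import Data.Integer.Base as ℤ using (ℤ; -[1+_]; 0ℤ; 1ℤ)
import Data.Integer.Divisibility.Signed as ℤ∣
open import Data.Integer.Divisibility.Signed using () renaming (_∣_ to _∣ℤ_)
import Data.Integer.Properties as ℤ
open import Data.Integer.Tactic.RingSolver using () renaming (solve-∀ to ℤ-solve-∀)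
open import Data.List.Base using ([]; _∷_)
import Data.List.Relation.Unary.All as ListAll
open import Data.Nat hiding (_/_)
import Data.Nat as ℕ
open import Data.Nat.Combinatorics using (nCk+nC[k+1]≡[n+1]C[k+1]) renaming (_C_ to _choose_)
open import Data.Nat.DivMod
  using (_mod_; m≡m%n+[m/n]*n; m%n<n; m/n*n≤m; m/n≤m; /-mono-≤; m*n/n≡m)
open import Data.Nat.Divisibility
  using (_∣_; divides; ∣-trans; ∣⇒≤; 1∣_; m∣m*n; *-pres-∣; m≤n⇒m!∣n!)
open import Data.Nat.ListAction using (product)
open import Data.Nat.Primality
  using (Prime; prime?; prime⇒nonZero; prime⇒nonTrivial; euclidsLemma)
open import Data.Nat.Primality.Factorisation using (factorise)
open import Data.Nat.Properties
open import Data.Nat.Tactic.RingSolver using (solve-∀)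
open import Data.Product
  using (Σ-syntax; ∃-syntax; _×_; _,_; proj₁; proj₂; uncurry)
import Data.Product.Properties as Product
open import Data.Rational using (_/_)
open import Data.Rational.Base as ℚ using (ℚ; mkℚ; 0ℚ; toℚᵘ)
import Data.Rational.Properties as ℚ
open import Data.Rational.Unnormalised.Base as ℚᵘ using (mkℚᵘ; *≡*; *≤*)
import Data.Rational.Unnormalised.Properties as ℚᵘ
open import Data.Sum.Base as Sum using (_⊎_; inj₁; inj₂)
import Data.Sum.Properties as Sum
open import Data.Vec.Base using (Vec; []; _∷_; map; lookup; tabulate; insertAt; removeAt)
open import Data.Vec.Properties as Vec
  using (tabulate∘lookup; lookup∘tabulate; tabulate-cong; insertAt-removeAt)
open import Data.Vec.Relation.Unary.All as All using (All; []; _∷_)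
import Data.Vec.Relation.Unary.All.Properties as All
open import Function.Base using (_∘_; id)
open import Function.Definitions using (Injective)
open import Relation.Binary.Definitions using (DecidableEquality; tri<; tri≈; tri>)
open import Relation.Binary.PropositionalEquality hiding (J)
open import Relation.Nullary using (¬_; Dec; yes; no; contradiction; ¬?)
open import Relation.Nullary.Decidable using (True; toWitness; _×-dec_)
open import Relation.Unary using (Decidable)

-- Primes in short intervals

C-absorption : ∀ n k → (suc n choose suc k) * suc k ≡ suc n * (n choose k)
C-absorption zero    zero    = refl
C-absorption zero    (suc k) = refl
C-absorption (suc n) zero    = begin
  (suc (suc n) choose 1) * 1            ≡⟨ cong (_* 1) (nCk+nC[k+1]≡[n+1]C[k+1] (suc n) 0) ⟨
  (1 + (suc n choose 1)) * 1            ≡⟨ cong suc (C-absorption n 0) ⟩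
  1 + suc n * 1                    ∎
  where open ≡-Reasoning
C-absorption (suc n) (suc k) = begin
  (suc (suc n) choose suc (suc k)) * suc (suc k)  ≡⟨ cong (_* suc (suc k)) (nCk+nC[k+1]≡[n+1]C[k+1] (suc n) (suc k)) ⟨
  (X + Y) * suc (suc k)                      ≡⟨ regroup X Y k ⟩
  X * suc k + X + Y * suc (suc k)            ≡⟨ cong₂ (λ a b → a + X + b) (C-absorption n k) (C-absorption n (suc k)) ⟩
  suc n * (n choose k) + X + suc n * (n choose suc k)  ≡⟨ regroup′ n (n choose k) (n choose suc k) X ⟩
  X + suc n * ((n choose k) + (n choose suc k))        ≡⟨ cong (λ a → X + suc n * a) (nCk+nC[k+1]≡[n+1]C[k+1] n k) ⟩
  suc (suc n) * X                            ∎
  where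
  open ≡-Reasoning
  X Y : ℕ
  X = suc n choose suc k
  Y = suc n choose suc (suc k)
  regroup : ∀ x y k → (x + y) * suc (suc k) ≡ x * suc k + x + y * suc (suc k)
  regroup = solve-∀
  regroup′ : ∀ n a b x → suc n * a + x + suc n * b ≡ x + suc n * (a + b)
  regroup′ = solve-∀

C-shift : ∀ k r → ((k + r) choose suc k) * suc k ≡ ((k + r) choose k) * r
C-shift k r = +-cancelˡ-≡ (((k + r) choose k) * suc k) _ _ (begin
  X * suc k + Y * suc k              ≡⟨ *-distribʳ-+ (suc k) X Y ⟨
  (X + Y) * suc k                    ≡⟨ cong (_* suc k) (nCk+nC[k+1]≡[n+1]C[k+1] (k + r) k) ⟩
  (suc (k + r) choose suc k) * suc k      ≡⟨ C-absorption (k + r) k ⟩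
  suc (k + r) * X                    ≡⟨ regroup k r X ⟩
  X * suc k + X * r                  ∎)
  where
  open ≡-Reasoning
  X Y : ℕ
  X = (k + r) choose k
  Y = (k + r) choose suc k
  regroup : ∀ k r x → suc (k + r) * x ≡ x * suc k + x * r
  regroup = solve-∀

-- The reciprocals 1 / (suc n * (n choose k)) form Leibniz's harmonic triangle: each
-- is an integer combination of 1 / 1, …, 1 / suc n.
suc[n]*nCk∣common-multiple : ∀ {D} k n → k ≤ n → (∀ i → 1 ≤ i → i ≤ suc n → i ∣ D) → suc n * (n choose k) ∣ D
suc[n]*nCk∣common-multiple {D} zero n k≤n all∣D = subst (_∣ D) (sym (*-identityʳ (suc n))) (all∣D (suc n) (s≤s z≤n) ≤-refl)
suc[n]*nCk∣common-multiple {D} (suc k) (suc n) (s≤s k≤n) all∣D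
  with suc[n]*nCk∣common-multiple k n k≤n (λ i 1≤i i≤ → all∣D i 1≤i (m≤n⇒m≤1+n i≤))
     | suc[n]*nCk∣common-multiple k (suc n) (m≤n⇒m≤1+n k≤n) all∣D
... | divides a D≡a | divides b D≡b = divides (a ∸ b) (*-cancelʳ-≡ D _ (suc k) (sym eq))
  where
  open ≡-Reasoning
  r X Z : ℕ
  r = suc n ∸ k
  X = suc n choose suc k
  Z = suc (suc n) * X * suc k

  k+r≡1+n : k + r ≡ suc n
  k+r≡1+n = m+[n∸m]≡n (m≤n⇒m≤1+n k≤n)

  shift : X * suc k ≡ (suc n choose k) * r
  shift = subst (λ m → (m choose suc k) * suc k ≡ (m choose k) * r) k+r≡1+n (C-shift k r)

  regroup₁ : ∀ a n x k → a * (suc n * x * k) ≡ a * (x * k) * suc n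
  regroup₁ = solve-∀
  regroup₂ : ∀ b n x r → b * (suc n * (x * r)) ≡ b * (suc n * x) * r
  regroup₂ = solve-∀

  aZ : a * Z ≡ D * suc (suc n)
  aZ = begin
    a * Z                                      ≡⟨ regroup₁ a (suc n) X (suc k) ⟩
    a * (X * suc k) * suc (suc n)              ≡⟨ cong (λ x → a * x * suc (suc n)) (C-absorption n k) ⟩
    a * (suc n * (n choose k)) * suc (suc n)        ≡⟨ cong (_* suc (suc n)) D≡a ⟨
    D * suc (suc n)                            ∎

  bZ : b * Z ≡ D * r
  bZ = begin
    b * Z                                      ≡⟨ cong (b *_) (trans (*-assoc (suc (suc n)) X (suc k)) (cong (suc (suc n) *_) shift)) ⟩
    b * (suc (suc n) * ((suc n choose k) * r))      ≡⟨ regroup₂ b (suc n) (suc n choose k) r ⟩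
    b * (suc (suc n) * (suc n choose k)) * r        ≡⟨ cong (_* r) D≡b ⟨
    D * r                                      ∎

  eq : (a ∸ b) * (suc (suc n) * X) * suc k ≡ D * suc k
  eq = begin
    (a ∸ b) * (suc (suc n) * X) * suc k        ≡⟨ *-assoc (a ∸ b) (suc (suc n) * X) (suc k) ⟩
    (a ∸ b) * Z                                ≡⟨ *-distribʳ-∸ Z a b ⟩
    a * Z ∸ b * Z                              ≡⟨ cong₂ _∸_ aZ bZ ⟩
    D * suc (suc n) ∸ D * r                    ≡⟨ cong (λ m → D * suc m ∸ D * r) k+r≡1+n ⟨
    D * (suc k + r) ∸ D * r                    ≡⟨ cong (_∸ D * r) (*-distribˡ-+ D (suc k) r) ⟩
    D * suc k + D * r ∸ D * r                  ≡⟨ m+n∸n≡m (D * suc k) (D * r) ⟩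
    D * suc k                                  ∎

-- Pascal's rule, applied twice, writes the next central coefficient as a sum of four terms, two of
-- which are the present one.
2^m≤[2m]Cm : ∀ m → 2 ^ m ≤ (m + m) choose m
2^m≤[2m]Cm zero = ≤-refl
2^m≤[2m]Cm (suc zero) = ≤-refl
2^m≤[2m]Cm (suc m@(suc l)) = begin
  2 ^ m + (2 ^ m + 0)                                  ≡⟨ cong (λ x → 2 ^ m + x) (+-identityʳ _) ⟩
  2 ^ m + 2 ^ m                                        ≤⟨ +-mono-≤ (≤-trans (2^m≤[2m]Cm m) (m≤n+m _ ((m + m) choose l))) (≤-trans (2^m≤[2m]Cm m) (m≤m+n _ ((m + m) choose suc m))) ⟩
  ((m + m) choose l + (m + m) choose m) + ((m + m) choose m + (m + m) choose suc m)
                                                       ≡⟨ cong₂ _+_ (nCk+nC[k+1]≡[n+1]C[k+1] (m + m) l) (nCk+nC[k+1]≡[n+1]C[k+1] (m + m) m) ⟩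
  suc (m + m) choose m + suc (m + m) choose suc m                ≡⟨ nCk+nC[k+1]≡[n+1]C[k+1] (suc (m + m)) m ⟩
  suc (suc (m + m)) choose suc m                            ≡⟨ cong (λ a → suc a choose suc m) (+-suc m m) ⟨
  (suc m + suc m) choose suc m                                ∎
  where open ≤-Reasoning

prime-divisor : ∀ n → 2 ≤ n → ∃[ p ] Prime p × p ∣ n
prime-divisor n@(suc _) 2≤n with factorise n
... | record { factors = []     ; isFactorisation = refl } = contradiction 2≤n λ { (s≤s ()) }
... | record { factors = p ∷ ps ; isFactorisation = eq ; factorsPrime = pr ListAll.∷ _ } =
  p , pr , divides (product ps) (trans eq (*-comm p (product ps)))

!∣ : ∀ {i} x → 1 ≤ i → i ≤ x → i ∣ x !
!∣ {suc i} x _ i<x = ∣-trans (m∣m*n (i !)) (m≤n⇒m!∣n! i<x)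

x!≤x^x : ∀ x → x ! ≤ x ^ x
x!≤x^x zero    = ≤-refl
x!≤x^x (suc x) = *-monoʳ-≤ (suc x) (≤-trans (x!≤x^x x) (^-monoˡ-≤ x (n≤1+n x)))

-- A number below `2 ^ s` has fewer than `s` prime factors, counted with multiplicity; each is at
-- most `x` and so divides `x !`.
smooth∣ : ∀ x r → (∀ p → p < 2 ^ r → Prime p → p ≤ x) →
          ∀ s → s ≤ r → ∀ i → 1 ≤ i → i < 2 ^ s → i ∣ (x !) ^ s
smooth∣ x r small zero    s≤r i 1≤i i<1 = contradiction i<1 (≤⇒≯ 1≤i)
smooth∣ x r small (suc s) s<r i 1≤i i<2^1+s with 2 ≤? i
... | no  i≱2 = subst (_∣ (x !) ^ suc s) (≤-antisym 1≤i (≤-pred (≰⇒> i≱2))) (1∣ _)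
... | yes 2≤i with prime-divisor i 2≤i
...   | p , pr , divides q refl = subst (_∣ (x !) ^ suc s) (*-comm p q)
          (*-pres-∣ (!∣ x 1≤p (small p p<2^r pr))
                    (smooth∣ x r small s (<⇒≤ s<r) q 1≤q q<2^s))
  where
  instance
    p≢0 : NonZero p
    p≢0 = prime⇒nonZero pr
    q≢0 : NonZero q
    q≢0 = ≢-nonZero λ { refl → contradiction 1≤i λ () }
  1≤p : 1 ≤ p
  1≤p = >-nonZero⁻¹ p
  1≤q : 1 ≤ q
  1≤q = >-nonZero⁻¹ q
  p<2^r : p < 2 ^ r
  p<2^r = ≤-<-trans (m≤n*m p q) (<-≤-trans i<2^1+s (^-monoʳ-≤ 2 s<r))
  q<2^s : q < 2 ^ s
  q<2^s = *-cancelˡ-< 2 q (2 ^ s) (≤-<-trans (≤-trans (≤-reflexive (*-comm 2 q)) (*-monoʳ-≤ q (nonTrivial⇒n>1 p {{prime⇒nonTrivial pr}}))) i<2^1+s)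

-- If there were no such prime, then (2 ^ u) ! ^ suc s would be a common multiple
-- of all i < 2 ^ suc s, hence divisible by a huge binomial coefficient.
prime-between : ∀ u s → suc (u * 2 ^ u * suc s) < 2 ^ s → ∃[ p ] Prime p × 2 ^ u < p × p < 2 ^ suc s
prime-between u s large with anyUpTo? (λ p → prime? p ×-dec 2 ^ u <? p) (2 ^ suc s)
... | yes (p , p<2^r , pr , 2^u<p) = p , pr , 2^u<p , p<2^r
... | no ∄p = contradiction 2^m≤ (<⇒≱ (^-monoʳ-< 2 (s≤s (s≤s z≤n)) (≤-pred large′)))
  where
  open ≤-Reasoning
  x m D : ℕ
  x = 2 ^ u
  -- Then `2m + 1` is the largest number below `2 ^ suc s`, so that `smooth∣` covers all of 1, ...,
  -- `2m + 1`.
  m = pred (2 ^ s)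
  D = (x !) ^ suc s
  instance
    2^s≢0 : NonZero (2 ^ s)
    2^s≢0 = m^n≢0 2 s
    D≢0 : NonZero D
    D≢0 = m^n≢0 (x !) (suc s) {{x !≢0}}
  1+m≡2^s : suc m ≡ 2 ^ s
  1+m≡2^s = suc-pred (2 ^ s)
  large′ : suc (u * x * suc s) < suc m
  large′ = subst (suc (u * x * suc s) <_) (sym 1+m≡2^s) large
  small : ∀ p → p < 2 ^ suc s → Prime p → p ≤ x
  small p p<2^r pr = ≮⇒≥ λ x<p → ∄p (p , p<2^r , pr , x<p)
  2m+1<2^r : suc (m + m) < 2 ^ suc s
  2m+1<2^r = ≤-reflexive (trans (cong suc (sym (+-suc m m))) (trans (cong (λ a → a + a) 1+m≡2^s) (cong (λ x → 2 ^ s + x) (sym (+-identityʳ _)))))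
  C∣D : suc (m + m) * ((m + m) choose m) ∣ D
  C∣D = suc[n]*nCk∣common-multiple m (m + m) (m≤m+n m m)
          (λ i 1≤i i≤ → smooth∣ x (suc s) small (suc s) ≤-refl i 1≤i (≤-<-trans i≤ 2m+1<2^r))
  2^m≤ : 2 ^ m ≤ 2 ^ (u * x * suc s)
  2^m≤ = begin
    2 ^ m                          ≤⟨ 2^m≤[2m]Cm m ⟩
    (m + m) choose m                    ≤⟨ m≤n*m _ (suc (m + m)) ⟩
    suc (m + m) * ((m + m) choose m)    ≤⟨ ∣⇒≤ C∣D ⟩
    (x !) ^ suc s                  ≤⟨ ^-monoˡ-≤ (suc s) (x!≤x^x x) ⟩
    (x ^ x) ^ suc s                ≡⟨ cong (_^ suc s) (^-*-assoc 2 u x) ⟩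
    (2 ^ (u * x)) ^ suc s          ≡⟨ ^-*-assoc 2 (u * x) (suc s) ⟩
    2 ^ (u * x * suc s)            ∎

-- Closed walks in algebraically defined graphs

-- A row `(s , d)` stands for a node `s` with unknown `d`: the sums for `e` = 0, 1, ... are the
-- equations of a Vandermonde system.
powerSum : ∀ {l} → ℕ → Vec (ℤ × ℤ) l → ℤ
powerSum e []             = 0ℤ
powerSum e ((s , d) ∷ xs) = s ℤ.^ e ℤ.* d ℤ.+ powerSum e xs

pos-^ : ∀ m e → + (m ^ e) ≡ (+ m) ℤ.^ e
pos-^ m zero    = refl
pos-^ m (suc e) = trans (ℤ.pos-* m (m ^ e)) (cong (+ m ℤ.*_) (pos-^ m e))

weight : ∀ {l} → ℤ → Vec (ℤ × ℤ) l → Vec (ℤ × ℤ) l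
weight r = map λ (s , d) → s , d ℤ.* (s ℤ.- r)

powerSum-weight : ∀ {l} r e (xs : Vec (ℤ × ℤ) l) → powerSum e (weight r xs) ≡ powerSum (suc e) xs ℤ.- r ℤ.* powerSum e xs
powerSum-weight r e []             = sym (cong (λ z → 0ℤ ℤ.- z) (ℤ.*-zeroʳ r))
powerSum-weight r e ((s , d) ∷ xs) =
  trans (cong (λ z → s ℤ.^ e ℤ.* (d ℤ.* (s ℤ.- r)) ℤ.+ z) (powerSum-weight r e xs))
        (regroup (s ℤ.^ e) d s r (powerSum (suc e) xs) (powerSum e xs))
  where
  regroup : ∀ a d s r x y → a ℤ.* (d ℤ.* (s ℤ.- r)) ℤ.+ (x ℤ.- r ℤ.* y) ≡ s ℤ.* a ℤ.* d ℤ.+ x ℤ.- r ℤ.* (a ℤ.* d ℤ.+ y)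
  regroup = ℤ-solve-∀

residues : ∀ {p} (x y z : ℕ) c → + p ∣ℤ + (x + y) ℤ.- c → + p ∣ℤ + (x + z) ℤ.- c → + p ∣ℤ + y ℤ.- + z
residues {p} x y z c p∣y p∣z = subst (+ p ∣ℤ_)
  (trans (cong₂ (λ a b → a ℤ.- c ℤ.- (b ℤ.- c)) (ℤ.pos-+ x y) (ℤ.pos-+ x z)) (cancel (+ x) (+ y) (+ z) c))
  (ℤ∣.∣m∣n⇒∣m-n p∣y p∣z)
  where
  cancel : ∀ x y z c → x ℤ.+ y ℤ.- c ℤ.- (x ℤ.+ z ℤ.- c) ≡ y ℤ.- z
  cancel = ℤ-solve-∀

module _ {p : ℕ} (p-prime : Prime p) where

  euclidsLemmaℤ : ∀ x y → + p ∣ℤ x ℤ.* y → + p ∣ℤ x ⊎ + p ∣ℤ y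
  euclidsLemmaℤ x y p∣xy = Sum.map ℤ∣.∣ᵤ⇒∣ ℤ∣.∣ᵤ⇒∣
    (euclidsLemma ℤ.∣ x ∣ ℤ.∣ y ∣ p-prime (subst (p ∣_) (ℤ.abs-* x y) (ℤ∣.∣⇒∣ᵤ p∣xy)))

  ∣*∤⇒∣ : ∀ x {y} → + p ∣ℤ x ℤ.* y → ¬ (+ p ∣ℤ y) → + p ∣ℤ x
  ∣*∤⇒∣ x p∣xy p∤y with euclidsLemmaℤ x _ p∣xy
  ... | inj₁ p∣x = p∣x
  ... | inj₂ p∣y = contradiction p∣y p∤y

  ∣-difference⇒≡ : ∀ {m n} → m < p → n < p → + p ∣ℤ + m ℤ.- + n → m ≡ n
  ∣-difference⇒≡ {m} {n} m<p n<p p∣m-n with ℤ.∣ + m ℤ.- + n ∣ in eq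
  ... | zero  = ℤ.+-injective (ℤ.i-j≡0⇒i≡j (+ m) (+ n) (ℤ.∣i∣≡0⇒i≡0 eq))
  ... | suc d = contradiction (∣⇒≤ (subst (p ∣_) eq (ℤ∣.∣⇒∣ᵤ p∣m-n))) (<⇒≱ d<p)
    where
    d<p : suc d < p
    d<p = subst (_< p) (trans (cong ℤ.∣_∣ (sym (ℤ.[+m]-[+n]≡m⊖n m n))) eq)
            (≤-<-trans (ℤ.∣m⊝n∣≤m⊔n m n) (⊔-lub m<p n<p))

  -- Vandermonde: weighting by s − s′ removes the row of s′ and one power sum.
  unique-row⇒∣ : ∀ {l} (xs : Vec (ℤ × ℤ) l) s d → (∀ e → e ≤ l → + p ∣ℤ powerSum e ((s , d) ∷ xs)) →
                 All (λ (s′ , _) → ¬ (+ p ∣ℤ s ℤ.- s′)) xs → + p ∣ℤ d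
  unique-row⇒∣ []               s d p∣sums [] = subst (+ p ∣ℤ_) (simplify d) (p∣sums 0 z≤n)
    where
    simplify : ∀ d → 1ℤ ℤ.* d ℤ.+ 0ℤ ≡ d
    simplify = ℤ-solve-∀
  unique-row⇒∣ {suc l} ((r , d′) ∷ xs) s d p∣sums (s≢r ∷ s≢) =
    ∣*∤⇒∣ d (unique-row⇒∣ (weight r xs) s (d ℤ.* (s ℤ.- r)) p∣sums′ (All.map⁺ s≢)) s≢r
    where
    rows : Vec (ℤ × ℤ) (2 + l)
    rows = (s , d) ∷ (r , d′) ∷ xs

    vanish : ∀ a x d r b y → a ℤ.* x ℤ.+ (b ℤ.* (d ℤ.* (r ℤ.- r)) ℤ.+ y) ≡ a ℤ.* x ℤ.+ y
    vanish = ℤ-solve-∀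

    p∣sums′ : ∀ e → e ≤ l → + p ∣ℤ powerSum e ((s , d ℤ.* (s ℤ.- r)) ∷ weight r xs)
    p∣sums′ e e≤ = subst (+ p ∣ℤ_)
      (trans (sym (powerSum-weight r e rows)) (vanish (s ℤ.^ e) (d ℤ.* (s ℤ.- r)) d′ r (r ℤ.^ e) (powerSum e (weight r xs))))
      (ℤ∣.∣m∣n⇒∣m-n (p∣sums (suc e) (s≤s e≤)) (ℤ∣.∣n⇒∣m*n r (p∣sums e (m≤n⇒m≤1+n e≤))))

  infixr 5 _∷_
  -- `w` is one coordinate of the successive lines of a walk; at a point of colour `s` it changes by
  -- `s ^ e * d` modulo `p`. The changes telescope, so a closed chain makes `powerSum e` vanish
  -- modulo `p`.
  data Chain (e : ℕ) : ∀ {l} → ℤ → Vec (ℤ × ℤ) l → ℤ → Set where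
    []  : ∀ {w} → Chain e w [] w
    _∷_ : ∀ {l w w′ w″ s d} {xs : Vec (ℤ × ℤ) l} → + p ∣ℤ (w′ ℤ.- w) ℤ.- s ℤ.^ e ℤ.* d →
          Chain e w′ xs w″ → Chain e w ((s , d) ∷ xs) w″

  chain-sum : ∀ {l e w w′} {xs : Vec (ℤ × ℤ) l} → Chain e w xs w′ → + p ∣ℤ (w′ ℤ.- w) ℤ.- powerSum e xs
  chain-sum {w = w} [] = subst (+ p ∣ℤ_) (cancel w) (ℤ∣.divides 0ℤ refl)
    where
    cancel : ∀ w → 0ℤ ≡ (w ℤ.- w) ℤ.- 0ℤ
    cancel = ℤ-solve-∀
  chain-sum {e = e} {w} {w″} (_∷_ {w′ = w′} {s = s} {d} {xs} p∣ c) =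
    subst (+ p ∣ℤ_) (telescope w w′ w″ (s ℤ.^ e ℤ.* d) (powerSum e xs)) (ℤ∣.∣m∣n⇒∣m+n p∣ (chain-sum c))
    where
    telescope : ∀ w w′ w″ a b → (w′ ℤ.- w ℤ.- a) ℤ.+ (w″ ℤ.- w′ ℤ.- b) ≡ w″ ℤ.- w ℤ.- (a ℤ.+ b)
    telescope = ℤ-solve-∀

  closed-chain-sum : ∀ {l e w} {xs : Vec (ℤ × ℤ) l} → Chain e w xs w → + p ∣ℤ powerSum e xs
  closed-chain-sum {e = e} {w} {xs} c = subst (+ p ∣ℤ_) (cancel w (powerSum e xs)) (ℤ∣.∣m⇒∣-m (chain-sum c))
    where
    cancel : ∀ w x → ℤ.- (w ℤ.- w ℤ.- x) ≡ x
    cancel = ℤ-solve-∀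

lookup-injective : ∀ {A : Set} {n} {xs ys : Vec A n} → (∀ i → lookup xs i ≡ lookup ys i) → xs ≡ ys
lookup-injective {xs = xs} {ys} eq = trans (sym (tabulate∘lookup xs)) (trans (tabulate-cong eq) (tabulate∘lookup ys))

next : ∀ {l} .{{_ : NonZero l}} → Fin l → Fin l
next {l} i = suc (toℕ i) mod l

Vertex : ℕ → ℕ → Set
Vertex p κ = Fin p × Vec (Fin p) κ

Incident : ∀ {p κ} → (ℕ → ℕ → Vec ℕ κ) → Vertex p κ → Vertex p κ → Set
Incident {p} f (s , v) (t , w) =
  ∀ j → + p ∣ℤ + (toℕ (lookup v j) + toℕ (lookup w j)) ℤ.- + lookup (f (toℕ s) (toℕ t)) j

record ClosedWalk {p κ} (f : ℕ → ℕ → Vec ℕ κ) (l : ℕ) .{{_ : NonZero l}} : Set where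
  field
    point line    : Fin l → Vertex p κ
    incident      : ∀ i → Incident f (point i) (line i)
    incident-next : ∀ i → Incident f (point i) (line (next i))
    point-≢       : ∀ i → point i ≢ point (next i)
    line-≢        : ∀ i → line i ≢ line (next i)

module _ {p κ} (p-prime : Prime p) (f : ℕ → ℕ → Vec ℕ κ) where

  -- Given the point `(s , v)`, the colour `t` of a line determines its vector as `f(s, t) − v`.
  -- Together with the dual fact this gives consecutive points, and consecutive lines, of a closed
  -- walk different colours.
  line-unique : ∀ P L L′ → Incident f P L → Incident f P L′ → proj₁ L ≡ proj₁ L′ → L ≡ L′
  line-unique (s , v) (t , w) (_ , w′) inc inc′ refl = cong (t ,_) (lookup-injective λ j →
    Fin.toℕ-injective (∣-difference⇒≡ p-prime (Fin.toℕ<n _) (Fin.toℕ<n _)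
      (residues (toℕ (lookup v j)) (toℕ (lookup w j)) (toℕ (lookup w′ j)) (+ lookup (f (toℕ s) (toℕ t)) j)
                (inc j) (inc′ j))))

  point-unique : ∀ P P′ L → Incident f P L → Incident f P′ L → proj₁ P ≡ proj₁ P′ → P ≡ P′
  point-unique (s , v) (_ , v′) (t , w) inc inc′ refl = cong (s ,_) (lookup-injective λ j →
    let c = + lookup (f (toℕ s) (toℕ t)) j
        flip : ∀ x y → + p ∣ℤ + (x + y) ℤ.- c → + p ∣ℤ + (y + x) ℤ.- c
        flip x y = subst (λ m → + p ∣ℤ + m ℤ.- c) (+-comm x y)
    in  Fin.toℕ-injective (∣-difference⇒≡ p-prime (Fin.toℕ<n _) (Fin.toℕ<n _)
          (residues (toℕ (lookup w j)) (toℕ (lookup v j)) (toℕ (lookup v′ j)) c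
                    (flip (toℕ (lookup v j)) _ (inc j)) (flip (toℕ (lookup v′ j)) _ (inc′ j)))))

  module ClosedWalkProperties {l} .{{_ : NonZero l}} (walk : ClosedWalk {p} f l) where
    open ClosedWalk walk

    c : Fin l → Fin p
    c i = proj₁ (point i)

    s t : Fin l → ℤ
    s i = + toℕ (proj₁ (point i))
    t i = + toℕ (proj₁ (line i))

    c-≢ : ∀ i → c i ≢ c (next i)
    c-≢ i eq = point-≢ i (point-unique _ _ (line (next i)) (incident-next i) (incident (next i)) eq)

    t-≢ : ∀ i → ¬ (+ p ∣ℤ t (next i) ℤ.- t i)
    t-≢ i p∣ = line-≢ i (line-unique (point i) _ _ (incident i) (incident-next i)
      (Fin.toℕ-injective (sym (∣-difference⇒≡ p-prime (Fin.toℕ<n _) (Fin.toℕ<n _) p∣))))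

    s-≢ : ∀ i j → c i ≢ c j → ¬ (+ p ∣ℤ s i ℤ.- s j)
    s-≢ i j c≢ p∣ = c≢ (Fin.toℕ-injective (∣-difference⇒≡ p-prime (Fin.toℕ<n _) (Fin.toℕ<n _) p∣))

    -- The node is the colour of the point, the unknown is the change of `t ^ k` between its two
    -- lines on the walk.
    row : ℕ → Fin l → ℤ × ℤ
    row k i = s i , t (next i) ℤ.^ k ℤ.- t i ℤ.^ k

    rows : ℕ → ∀ n → Fin l → Vec (ℤ × ℤ) n
    rows k zero    i = []
    rows k (suc n) i = row k i ∷ rows k n (next i)

    advance : ℕ → Fin l → Fin l
    advance zero    i = i
    advance (suc n) i = advance n (next i)

    chain : ∀ {e} k (w : Fin l → ℤ) → (∀ i → + p ∣ℤ w (next i) ℤ.- w i ℤ.- s i ℤ.^ e ℤ.* (t (next i) ℤ.^ k ℤ.- t i ℤ.^ k)) →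
            ∀ n i → Chain p-prime e (w i) (rows k n i) (w (advance n i))
    chain k w step zero    i = []
    chain k w step (suc n) i = step i ∷ chain k w step n (next i)

    -- The colour of a line behaves like a coordinate for the monomial `t`: the equation with
    -- exponent 0 comes from the colours alone.
    constant-step : ∀ i → + p ∣ℤ t (next i) ℤ.- t i ℤ.- s i ℤ.^ 0 ℤ.* (t (next i) ℤ.^ 1 ℤ.- t i ℤ.^ 1)
    constant-step i = subst (+ p ∣ℤ_) (vanish (t (next i)) (t i)) (ℤ∣.divides 0ℤ refl)
      where
      vanish : ∀ x y → 0ℤ ≡ x ℤ.- y ℤ.- 1ℤ ℤ.* (x ℤ.* 1ℤ ℤ.- y ℤ.* 1ℤ)
      vanish = ℤ-solve-∀

    -- Subtracting the two incidences at point `i` cancels the coordinate of the point.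
    monomial-step : ∀ j e k → (∀ s t → lookup (f s t) j ≡ s ^ e * t ^ k) → ∀ i →
      + p ∣ℤ + toℕ (lookup (proj₂ (line (next i))) j) ℤ.- + toℕ (lookup (proj₂ (line i)) j)
             ℤ.- s i ℤ.^ e ℤ.* (t (next i) ℤ.^ k ℤ.- t i ℤ.^ k)
    monomial-step j e k f≡ i = subst (+ p ∣ℤ_)
      (trans (cong₂ ℤ._-_ (cong₂ ℤ._-_ (ℤ.pos-+ v w′) (f-pos (next i))) (cong₂ ℤ._-_ (ℤ.pos-+ v w) (f-pos i)))
             (regroup (+ v) (+ w′) (+ w) (s i ℤ.^ e) (t (next i) ℤ.^ k) (t i ℤ.^ k)))
      (ℤ∣.∣m∣n⇒∣m-n (incident-next i j) (incident i j))
      where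
      v w w′ : ℕ
      v  = toℕ (lookup (proj₂ (point i)) j)
      w  = toℕ (lookup (proj₂ (line i)) j)
      w′ = toℕ (lookup (proj₂ (line (next i))) j)
      f-pos : ∀ i′ → + lookup (f (toℕ (c i)) (toℕ (proj₁ (line i′)))) j ≡ s i ℤ.^ e ℤ.* t i′ ℤ.^ k
      f-pos i′ = trans (cong +_ (f≡ _ _)) (trans (ℤ.pos-* (toℕ (c i) ^ e) _) (cong₂ ℤ._*_ (pos-^ _ e) (pos-^ _ k)))
      regroup : ∀ v w′ w a x y → v ℤ.+ w′ ℤ.- a ℤ.* x ℤ.- (v ℤ.+ w ℤ.- a ℤ.* y) ≡ w′ ℤ.- w ℤ.- a ℤ.* (x ℤ.- y)
      regroup = ℤ-solve-∀

    constant-sum : ∀ n i → advance n i ≡ i → + p ∣ℤ powerSum 0 (rows 1 n i)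
    constant-sum n i closed = closed-chain-sum p-prime
      (subst (Chain p-prime 0 _ _) (cong t closed) (chain 1 t constant-step n i))

    monomial-sum : ∀ j e k → (∀ s t → lookup (f s t) j ≡ s ^ e * t ^ k) →
                   ∀ n i → advance n i ≡ i → + p ∣ℤ powerSum e (rows k n i)
    monomial-sum j e k f≡ n i closed = closed-chain-sum p-prime
      (subst (Chain p-prime e _ _) (cong (λ i → + toℕ (lookup (proj₂ (line i)) j)) closed)
             (chain k (λ i → + toℕ (lookup (proj₂ (line i)) j)) (monomial-step j e k f≡) n i))

    -- If the colour of point `i` occurred only once, Vandermonde would make `t (next i) − t i`
    -- divisible by `p`, but consecutive lines have different colours.
    no-unique-point : ∀ n i → (∀ e → e ≤ n → + p ∣ℤ powerSum e (rows 1 (suc n) i)) →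
                      ¬ All (λ (s′ , _) → ¬ (+ p ∣ℤ s i ℤ.- s′)) (rows 1 n (next i))
    no-unique-point n i p∣sums s≢ = t-≢ i (subst (+ p ∣ℤ_)
      (cong₂ ℤ._-_ (ℤ.*-identityʳ (t (next i))) (ℤ.*-identityʳ (t i)))
      (unique-row⇒∣ p-prime _ _ _ p∣sums s≢))

-- f₆ and f₁₀ define Wenger's graphs. These contain 8-cycles whose points have
-- alternating first coordinates; the monomial s t² of f₈ excludes them.

f₆ : ℕ → ℕ → Vec ℕ 2
f₆ s t = s ^ 1 * t ^ 1 ∷ s ^ 2 * t ^ 1 ∷ []

f₈ f₁₀ : ℕ → ℕ → Vec ℕ 4
f₈  s t = s ^ 1 * t ^ 1 ∷ s ^ 2 * t ^ 1 ∷ s ^ 3 * t ^ 1 ∷ s ^ 1 * t ^ 2 ∷ []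
f₁₀ s t = s ^ 1 * t ^ 1 ∷ s ^ 2 * t ^ 1 ∷ s ^ 3 * t ^ 1 ∷ s ^ 4 * t ^ 1 ∷ []

module _ {p} (p-prime : Prime p) where

  -- Any two of the three points are consecutive, so all colours are distinct.
  no-hexagon : ¬ ClosedWalk {p} f₆ 3
  no-hexagon walk = no-unique-point 2 0F sums
      (s-≢ 0F 1F (c-≢ 0F) ∷ s-≢ 0F 2F (≢-sym (c-≢ 2F)) ∷ [])
    where
    open ClosedWalkProperties p-prime f₆ walk
    sums : ∀ e → e ≤ 2 → + p ∣ℤ powerSum e (rows 1 3 0F)
    sums 0 _ = constant-sum 3 0F refl
    sums 1 _ = monomial-sum 0F 1 1 (λ _ _ → refl) 3 0F refl
    sums 2 _ = monomial-sum 1F 2 1 (λ _ _ → refl) 3 0F refl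
    sums (suc (suc (suc _))) (s≤s (s≤s ()))

  no-decagon : ¬ ClosedWalk {p} f₁₀ 5
  no-decagon walk = cases (c 0F Fin.≟ c 2F) (c 0F Fin.≟ c 3F)
    where
    open ClosedWalkProperties p-prime f₁₀ walk
    cyclic : ∀ i → advance 5 i ≡ i
    cyclic 0F = refl
    cyclic 1F = refl
    cyclic 2F = refl
    cyclic 3F = refl
    cyclic 4F = refl

    sums : ∀ i e → e ≤ 4 → + p ∣ℤ powerSum e (rows 1 5 i)
    sums i 0 _ = constant-sum 5 i (cyclic i)
    sums i 1 _ = monomial-sum 0F 1 1 (λ _ _ → refl) 5 i (cyclic i)
    sums i 2 _ = monomial-sum 1F 2 1 (λ _ _ → refl) 5 i (cyclic i)
    sums i 3 _ = monomial-sum 2F 3 1 (λ _ _ → refl) 5 i (cyclic i)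
    sums i 4 _ = monomial-sum 3F 4 1 (λ _ _ → refl) 5 i (cyclic i)
    sums i (suc (suc (suc (suc (suc _))))) (s≤s (s≤s (s≤s (s≤s ()))))

    no-isolated : ∀ i → c i ≢ c (advance 2 i) → c i ≢ c (advance 3 i) → ⊥
    no-isolated i c≢₂ c≢₃ = no-unique-point 4 i (sums i)
      ( s-≢ i (advance 1 i) (c-≢ i)
      ∷ s-≢ i (advance 2 i) c≢₂
      ∷ s-≢ i (advance 3 i) c≢₃
      ∷ s-≢ i (advance 4 i) (λ eq → c-≢ (advance 4 i) (trans (sym eq) (cong c (sym (cyclic i)))))
      ∷ [])

    -- Every colour class has at most two of the five points, hence some class is a singleton.
    cases : Dec (c 0F ≡ c 2F) → Dec (c 0F ≡ c 3F) → ⊥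
    cases (no 0≢2)  (no 0≢3)  = no-isolated 0F 0≢2 0≢3
    cases (yes 0≡2) _ with c 1F Fin.≟ c 3F
    ... | no 1≢3  = no-isolated 3F (λ 3≡0 → c-≢ 2F (sym (trans 3≡0 0≡2))) (≢-sym 1≢3)
    ... | yes 1≡3 = no-isolated 4F (λ 4≡1 → c-≢ 3F (sym (trans 4≡1 1≡3))) (λ 4≡2 → c-≢ 4F (trans 4≡2 (sym 0≡2)))
    cases (no 0≢2)  (yes 0≡3) with c 2F Fin.≟ c 4F
    ... | no 2≢4  = no-isolated 2F 2≢4 (≢-sym 0≢2)
    ... | yes 2≡4 = no-isolated 1F (λ 1≡3 → c-≢ 0F (trans 0≡3 (sym 1≡3))) (λ 1≡4 → c-≢ 1F (trans 1≡4 (sym 2≡4)))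

  -- Either some colour is unique among the four points, or the colours alternate between two
  -- values. In the second case the monomials `s t` and `s t²` give `t₀ + t₂ ≡ t₁ + t₃` and the same
  -- for the squares, which for odd `p` forces `t₁ ≡ t₀` or `t₂ ≡ t₁`.
  no-octagon : 2 < p → ¬ ClosedWalk {p} f₈ 4
  no-octagon 2<p walk = cases (c 0F Fin.≟ c 2F) (c 1F Fin.≟ c 3F)
    where
    open ClosedWalkProperties p-prime f₈ walk
    cyclic : ∀ i → advance 4 i ≡ i
    cyclic 0F = refl
    cyclic 1F = refl
    cyclic 2F = refl
    cyclic 3F = refl

    sums : ∀ i e → e ≤ 3 → + p ∣ℤ powerSum e (rows 1 4 i)
    sums i 0 _ = constant-sum 4 i (cyclic i)
    sums i 1 _ = monomial-sum 0F 1 1 (λ _ _ → refl) 4 i (cyclic i)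
    sums i 2 _ = monomial-sum 1F 2 1 (λ _ _ → refl) 4 i (cyclic i)
    sums i 3 _ = monomial-sum 2F 3 1 (λ _ _ → refl) 4 i (cyclic i)
    sums i (suc (suc (suc (suc _)))) (s≤s (s≤s (s≤s ())))

    no-isolated : ∀ i → c i ≢ c (advance 2 i) → ⊥
    no-isolated i c≢₂ = no-unique-point 3 i (sums i)
      ( s-≢ i (advance 1 i) (c-≢ i)
      ∷ s-≢ i (advance 2 i) c≢₂
      ∷ s-≢ i (advance 3 i) (λ eq → c-≢ (advance 3 i) (trans (sym eq) (cong c (sym (cyclic i)))))
      ∷ [])

    p∤2 : ¬ (+ p ∣ℤ + 2)
    p∤2 p∣2 = <⇒≱ 2<p (∣⇒≤ (ℤ∣.∣⇒∣ᵤ p∣2))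

    t₀ t₁ t₂ t₃ : ℤ
    t₀ = t 0F
    t₁ = t 1F
    t₂ = t 2F
    t₃ = t 3F

    module _ (c₀≡c₂ : c 0F ≡ c 2F) (c₁≡c₃ : c 1F ≡ c 3F) where

      -- With colours `a, b, a, b`, the first power sum minus `b` times the zeroth leaves
      -- `(d₀ + d₂) (a − b)`, and `a ≢ b` modulo `p`.
      alternating : ∀ k → + p ∣ℤ powerSum 1 (rows k 4 0F) → + p ∣ℤ powerSum 0 (rows k 4 0F) →
                    + p ∣ℤ (t₁ ℤ.^ k ℤ.- t₀ ℤ.^ k) ℤ.+ (t₃ ℤ.^ k ℤ.- t₂ ℤ.^ k)
      alternating k p∣₁ p∣₀ = ∣*∤⇒∣ p-prime _
        (subst (+ p ∣ℤ_)
          (trans (cong₂ (λ a b → s 0F ℤ.^ 1 ℤ.* d₀ ℤ.+ (s 1F ℤ.^ 1 ℤ.* d₁ ℤ.+ (a ℤ.^ 1 ℤ.* d₂ ℤ.+ (b ℤ.^ 1 ℤ.* d₃ ℤ.+ 0ℤ))) ℤ.- s 1F ℤ.* Σd)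
                        (cong (λ a → + toℕ a) (sym c₀≡c₂)) (cong (λ a → + toℕ a) (sym c₁≡c₃)))
                 (regroup (s 0F) (s 1F) d₀ d₁ d₂ d₃))
          (ℤ∣.∣m∣n⇒∣m-n p∣₁ (ℤ∣.∣n⇒∣m*n (s 1F) p∣₀)))
        (s-≢ 0F 1F (c-≢ 0F))
        where
        d₀ d₁ d₂ d₃ Σd : ℤ
        d₀ = t₁ ℤ.^ k ℤ.- t₀ ℤ.^ k
        d₁ = t₂ ℤ.^ k ℤ.- t₁ ℤ.^ k
        d₂ = t₃ ℤ.^ k ℤ.- t₂ ℤ.^ k
        d₃ = t₀ ℤ.^ k ℤ.- t₃ ℤ.^ k
        Σd = powerSum 0 (rows k 4 0F)
        regroup : ∀ a b d₀ d₁ d₂ d₃ →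
          a ℤ.* 1ℤ ℤ.* d₀ ℤ.+ (b ℤ.* 1ℤ ℤ.* d₁ ℤ.+ (a ℤ.* 1ℤ ℤ.* d₂ ℤ.+ (b ℤ.* 1ℤ ℤ.* d₃ ℤ.+ 0ℤ)))
            ℤ.- b ℤ.* (1ℤ ℤ.* d₀ ℤ.+ (1ℤ ℤ.* d₁ ℤ.+ (1ℤ ℤ.* d₂ ℤ.+ (1ℤ ℤ.* d₃ ℤ.+ 0ℤ))))
          ≡ (d₀ ℤ.+ d₂) ℤ.* (a ℤ.- b)
        regroup = ℤ-solve-∀

      squares-telescope : + p ∣ℤ powerSum 0 (rows 2 4 0F)
      squares-telescope = subst (+ p ∣ℤ_) (vanish (t₀ ℤ.^ 2) (t₁ ℤ.^ 2) (t₂ ℤ.^ 2) (t₃ ℤ.^ 2)) (ℤ∣.divides 0ℤ refl)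
        where
        vanish : ∀ a b c d → 0ℤ ≡ 1ℤ ℤ.* (b ℤ.- a) ℤ.+ (1ℤ ℤ.* (c ℤ.- b) ℤ.+ (1ℤ ℤ.* (d ℤ.- c) ℤ.+ (1ℤ ℤ.* (a ℤ.- d) ℤ.+ 0ℤ)))
        vanish = ℤ-solve-∀

      -- The multiplier `t₀ + t₂ − t₁ + t₃` eliminates `t₃`: once the relation between the squares
      -- is subtracted, only the product of two differences survives.
      2d₀d₁ : + p ∣ℤ + 2 ℤ.* (t₁ ℤ.- t₀) ℤ.* (t₂ ℤ.- t₁)
      2d₀d₁ = subst (+ p ∣ℤ_) (regroup t₀ t₁ t₂ t₃)
        (ℤ∣.∣m∣n⇒∣m-n (ℤ∣.∣n⇒∣m*n (t₀ ℤ.+ t₂ ℤ.- t₁ ℤ.+ t₃) (alternating 1 (sums 0F 1 (s≤s z≤n)) (sums 0F 0 z≤n)))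
                      (alternating 2 (monomial-sum 3F 1 2 (λ _ _ → refl) 4 0F refl) squares-telescope))
        where
        regroup : ∀ a b c d →
          (a ℤ.+ c ℤ.- b ℤ.+ d) ℤ.* ((b ℤ.* 1ℤ ℤ.- a ℤ.* 1ℤ) ℤ.+ (d ℤ.* 1ℤ ℤ.- c ℤ.* 1ℤ))
            ℤ.- ((b ℤ.* (b ℤ.* 1ℤ) ℤ.- a ℤ.* (a ℤ.* 1ℤ)) ℤ.+ (d ℤ.* (d ℤ.* 1ℤ) ℤ.- c ℤ.* (c ℤ.* 1ℤ)))
          ≡ + 2 ℤ.* (b ℤ.- a) ℤ.* (c ℤ.- b)
        regroup = ℤ-solve-∀

    cases : Dec (c 0F ≡ c 2F) → Dec (c 1F ≡ c 3F) → ⊥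
    cases (no 0≢2)  _         = no-isolated 0F 0≢2
    cases (yes _)   (no 1≢3)  = no-isolated 1F 1≢3
    cases (yes 0≡2) (yes 1≡3) = p∤2 (∣*∤⇒∣ p-prime _ (∣*∤⇒∣ p-prime _ (2d₀d₁ 0≡2 1≡3) (t-≢ 1F)) (t-≢ 0F))

-- Greedy choice of chunks

funToFin-cong : ∀ {m n} {f g : Fin m → Fin n} → (∀ i → f i ≡ g i) → funToFin f ≡ funToFin g
funToFin-cong {zero}  f≗g = refl
funToFin-cong {suc m} f≗g = cong₂ combine (f≗g zero) (funToFin-cong (f≗g ∘ suc))

finToFun-injective : ∀ {m n} {c c′ : Fin (n ^ m)} → (∀ i → finToFun {n} {m} c i ≡ finToFun {n} {m} c′ i) → c ≡ c′
finToFun-injective {m} {n} {c} {c′} eq =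
  trans (sym (Fin.funToFin-finToFin {m} {n} c)) (trans (funToFin-cong eq) (Fin.funToFin-finToFin {m} {n} c′))

remQuot-injective : ∀ {m} n {c c′ : Fin (m * n)} → remQuot {m} n c ≡ remQuot n c′ → c ≡ c′
remQuot-injective {m} n {c} {c′} eq =
  trans (sym (Fin.combine-remQuot {m} n c)) (trans (cong (λ (i , j) → combine i j) eq) (Fin.combine-remQuot {m} n c′))

module _ {I : Set} (_≟I_ : DecidableEquality I) where

  -- Each forbidden value costs one index: the one that `g` maps to it, unique by injectivity, or
  -- index zero if there is none.
  avoid : ∀ D {q} (f : Fin D → I) (g : Fin (D + q) → I) → Injective _≡_ _≡_ g →
          Σ[ ι ∈ (Fin q → Fin (D + q)) ] Injective _≡_ _≡_ ι × (∀ a b → g (ι a) ≢ f b)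
  avoid zero    f g g-inj = id , id , λ _ ()
  avoid (suc D) f g g-inj with Fin.any? (λ a → g a ≟I f zero)
  ... | yes (a₀ , ga₀≡) with avoid D (f ∘ suc) (g ∘ punchIn a₀) (λ eq → Fin.punchIn-injective a₀ _ _ (g-inj eq))
  ...   | ι , ι-inj , ι-avoids = punchIn a₀ ∘ ι , (λ eq → ι-inj (Fin.punchIn-injective a₀ _ _ eq)) , λ where
            a zero    eq → Fin.punchInᵢ≢i a₀ (ι a) (g-inj (trans eq (sym ga₀≡)))
            a (suc b) eq → ι-avoids a b eq
  avoid (suc D) f g g-inj | no ∄ with avoid D (f ∘ suc) (g ∘ suc) (λ eq → Fin.suc-injective (g-inj eq))
  ...   | ι , ι-inj , ι-avoids = suc ∘ ι , (λ eq → ι-inj (Fin.suc-injective eq)) , λ where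
            a zero    eq → ∄ (suc (ι a) , eq)
            a (suc b) eq → ι-avoids a b eq

  -- An earlier item clashes with at most `D` items, so up to `r` earlier items leave at least `Q`
  -- of the `Z` items. `Q` is a successor in order that a default choice exists.
  module Greedy
    {D Q′ Z r : ℕ} (Clash : I → I → Set) (conflicts : I → Fin D → I)
    (listed : ∀ x y → Clash x y → ∃[ d ] x ≡ conflicts y d)
    (items : Fin Z → I) (items-injective : Injective _≡_ _≡_ items)
    (room : r * D + suc Q′ ≤ Z)
    where

    private
      Q : ℕ
      Q = suc Q′

    fresh : ∀ {l} (past : Vec I l) → l ≤ r →
            Σ[ pick ∈ (Fin Q → I) ] Injective _≡_ _≡_ pick × (∀ a i → ¬ Clash (pick a) (lookup past i))
    fresh {l} past l≤r with avoid (l * D) forbidden g g-injective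
      where
      forbidden : Fin (l * D) → I
      forbidden b = conflicts (lookup past (proj₁ (remQuot {l} D b))) (proj₂ (remQuot {l} D b))
      room′ : l * D + Q ≤ Z
      room′ = ≤-trans (+-monoˡ-≤ Q (*-monoˡ-≤ D l≤r)) room
      g : Fin (l * D + Q) → I
      g a = items (inject≤ a room′)
      g-injective : Injective _≡_ _≡_ g
      g-injective eq = Fin.inject≤-injective room′ room′ _ _ (items-injective eq)
    ... | ι , ι-inj , ι-avoids = _ ,
      (λ eq → ι-inj (Fin.inject≤-injective _ _ _ _ (items-injective eq))) ,
      λ a i clash → let d , eq = listed _ _ clash in
        ι-avoids a (combine i d)
          (trans eq (cong (λ b → conflicts (lookup past (proj₁ b)) (proj₂ b)) (sym (Fin.remQuot-combine i d))))

    pick : ∀ {l} (past : Vec I l) → l ≤ r → Fin Q → I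
    pick past l≤r = proj₁ (fresh past l≤r)

    past-short : ∀ l m → l + m ≡ r → l ≤ r
    past-short l m eq = m+n≤o⇒m≤o l (≤-reflexive eq)

    -- The first `m` items are steered by `cs`, while the last one takes the default choice: it will
    -- serve the possibly incomplete last block of the path, from which a choice could not be read
    -- off.
    greedy : ∀ {l} m → l + m ≡ r → Vec I l → Vec (Fin Q) m → Vec I (suc m)
    greedy {l} zero    eq past []       = pick past (past-short l zero eq) zero ∷ []
    greedy {l} (suc m) eq past (c ∷ cs) =
      let x = pick past (past-short l (suc m) eq) c
      in  x ∷ greedy m (trans (sym (+-suc l m)) eq) (x ∷ past) cs

    greedy-fresh : ∀ {l} m (eq : l + m ≡ r) past cs j i → ¬ Clash (lookup (greedy m eq past cs) j) (lookup past i)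
    greedy-fresh {l} zero    eq past []       zero    i = proj₂ (proj₂ (fresh past (past-short l zero eq))) zero i
    greedy-fresh {l} (suc m) eq past (c ∷ cs) zero    i = proj₂ (proj₂ (fresh past (past-short l (suc m) eq))) c i
    greedy-fresh (suc m) eq past (c ∷ cs) (suc j) i = greedy-fresh m _ _ cs j (suc i)

    greedy-clash-free : ∀ {l} m (eq : l + m ≡ r) past cs j k → toℕ j < toℕ k →
                        ¬ Clash (lookup (greedy m eq past cs) k) (lookup (greedy m eq past cs) j)
    greedy-clash-free zero    eq past []       zero    zero    ()
    greedy-clash-free (suc m) eq past (c ∷ cs) zero    (suc k) _         = greedy-fresh m _ _ cs k zero
    greedy-clash-free (suc m) eq past (c ∷ cs) (suc j) (suc k) (s≤s j<k) = greedy-clash-free m _ _ cs j k j<k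

    -- With the same past, equal items come from equal codes, and they then form the same past for
    -- the next step.
    greedy-injective : ∀ {l} m (eq : l + m ≡ r) past cs cs′ →
      (∀ j → lookup (greedy m eq past cs) (inject₁ j) ≡ lookup (greedy m eq past cs′) (inject₁ j)) → cs ≡ cs′
    greedy-injective zero    eq past []       []         same = refl
    greedy-injective {l} (suc m) eq past (c ∷ cs) (c′ ∷ cs′) same
      with proj₁ (proj₂ (fresh past (past-short l (suc m) eq))) (same zero)
    ... | refl = cong (c ∷_) (greedy-injective m _ _ cs cs′ (same ∘ suc))

-- Chunks as walks through coloured layers

module Items {R′ h M : ℕ} (T : ℕ → Fin h → Fin h → Fin M → Fin M)
             (T-involutive : ∀ ℓ a b v → T ℓ a b (T ℓ a b v) ≡ v) where

  R : ℕ
  R = suc R′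

  -- A walk through `R` layers is stored as its colours and its first vector; the maps `T` determine
  -- the other vectors.
  Item : Set
  Item = Vec (Fin h) R × Fin M

  val : ∀ {n} → ℕ → Vec (Fin h) n → Fin M → Fin n → Fin M
  val ℓ (a ∷ as)     v zero    = v
  val ℓ (a ∷ b ∷ as) v (suc i) = val (suc ℓ) (b ∷ as) (T ℓ a b v) i

  val-zero : ∀ {n} ℓ (as : Vec (Fin h) (suc n)) v → val ℓ as v zero ≡ v
  val-zero ℓ (a ∷ as) v = refl

  -- Since each `T ℓ a b` is an involution, the colours and the vector in any layer determine the
  -- first vector.
  back : ∀ {n} → ℕ → Vec (Fin h) n → Fin n → Fin M → Fin M
  back ℓ (a ∷ as)     zero    w = w
  back ℓ (a ∷ b ∷ as) (suc i) w = T ℓ a b (back (suc ℓ) (b ∷ as) i w)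

  back-val : ∀ {n} ℓ (as : Vec (Fin h) n) v i → back ℓ as i (val ℓ as v i) ≡ v
  back-val ℓ (a ∷ as)     v zero    = refl
  back-val ℓ (a ∷ b ∷ as) v (suc i) = trans (cong (T ℓ a b) (back-val (suc ℓ) (b ∷ as) (T ℓ a b v) i)) (T-involutive ℓ a b v)

  val-step : ∀ {n} ℓ (as : Vec (Fin h) n) v i i′ → suc (toℕ i) ≡ toℕ i′ →
             val ℓ as v i′ ≡ T (ℓ + toℕ i) (lookup as i) (lookup as i′) (val ℓ as v i)
  val-step ℓ (a ∷ b ∷ as) v zero    (suc zero)     _  = cong (λ m → T m a b v) (sym (+-identityʳ ℓ))
  val-step ℓ (a ∷ b ∷ as) v (suc i) (suc i′)       eq =
    trans (val-step (suc ℓ) (b ∷ as) (T ℓ a b v) i i′ (suc-injective eq))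
          (cong (λ m → T m (lookup (b ∷ as) i) (lookup (b ∷ as) i′) (val (suc ℓ) (b ∷ as) (T ℓ a b v) i)) (sym (+-suc ℓ (toℕ i))))

  at : Item → Fin R → Fin h × Fin M
  at (as , v) i = lookup as i , val 0 as v i

  at-injective : ∀ x y → (∀ i → at x i ≡ at y i) → x ≡ y
  at-injective (as , v) (bs , w) same = cong₂ _,_ (lookup-injective (cong proj₁ ∘ same))
    (trans (sym (val-zero 0 as v)) (trans (cong proj₂ (same zero)) (val-zero 0 bs w)))

  Clash : Item → Item → Set
  Clash x y = ∃[ i ] at x i ≡ at y i

  -- A chunk meeting `y` in layer `i` shares colour and vector there; its other `R′` colours are
  -- free, and its first vector follows by going `back`. Hence the count `R * h ^ R′`.
  conflicts : Item → Fin (R * h ^ R′) → Item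
  conflicts y d =
    let i , others = remQuot (h ^ R′) d
        a , w = at y i
        as = insertAt (tabulate (finToFun others)) i a
    in  as , back 0 as i w

  listed : ∀ x y → Clash x y → ∃[ d ] x ≡ conflicts y d
  listed (as , v) y (i , same) = combine i (funToFin (lookup others)) , sym (begin
    conflicts y (combine i (funToFin (lookup others)))   ≡⟨ cong rebuild (Fin.remQuot-combine i (funToFin (lookup others))) ⟩
    rebuild (i , funToFin (lookup others))               ≡⟨ cong (λ o → insertAt o i (proj₁ (at y i)) , back 0 (insertAt o i (proj₁ (at y i))) i (proj₂ (at y i)))
                                                              (trans (tabulate-cong (Fin.finToFun-funToFin (lookup others))) (tabulate∘lookup others)) ⟩
    reinsert (at y i)                                    ≡⟨ cong reinsert same ⟨
    reinsert (at (as , v) i)                             ≡⟨ cong (λ as′ → as′ , back 0 as′ i (val 0 as v i)) (insertAt-removeAt as i) ⟩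
    as , back 0 as i (val 0 as v i)                      ≡⟨ cong (as ,_) (back-val 0 as v i) ⟩
    as , v                                               ∎)
    where
    open ≡-Reasoning
    others : Vec (Fin h) R′
    others = removeAt as i
    rebuild : Fin R × Fin (h ^ R′) → Item
    rebuild (i , o) = let as = insertAt (tabulate (finToFun o)) i (proj₁ (at y i)) in as , back 0 as i (proj₂ (at y i))
    reinsert : Fin h × Fin M → Item
    reinsert (a , w) = insertAt others i a , back 0 (insertAt others i a) i w

  items : Fin (h ^ R * M) → Item
  items z = let c , v = remQuot M z in tabulate (finToFun c) , v

  items-injective : Injective _≡_ _≡_ items
  items-injective {z} {z′} eq = remQuot-injective {h ^ R} M (cong₂ _,_ (finToFun-injective {R} {h} λ i →
    trans (sym (lookup∘tabulate (colours z) i)) (trans (cong (λ x → lookup (proj₁ x) i) eq) (lookup∘tabulate (colours z′) i))) (cong proj₂ eq))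
    where
    colours : Fin (h ^ R * M) → Fin R → Fin h
    colours z = finToFun (proj₁ (remQuot {h ^ R} M z))

  _≟Item_ : DecidableEquality Item
  _≟Item_ = Product.≡-dec (Vec.≡-dec Fin._≟_) Fin._≟_

-- Counting embeddings of a family

funToFin-injective : ∀ {m n} {f g : Fin m → Fin n} → funToFin f ≡ funToFin g → ∀ i → f i ≡ g i
funToFin-injective {f = f} {g} eq i = trans (sym (Fin.finToFun-funToFin f i))
  (trans (cong (λ c → finToFun c i) eq) (Fin.finToFun-funToFin g i))

injective⇒surjective : ∀ {n} {f : Fin n → Fin n} → Injective _≡_ _≡_ f → ∀ u → ∃[ i ] f i ≡ u
injective⇒surjective {suc n} {f} f-inj u with Fin.any? (λ i → f i Fin.≟ u)
... | yes hit = hit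
... | no miss = contradiction (Fin.injective⇒≤ {f = λ i → punchOut (u≢f i)}
                  (λ {i} {j} eq → f-inj (Fin.punchOut-injective (u≢f i) (u≢f j) eq))) (<⇒≱ ≤-refl)
  where
  u≢f : ∀ i → u ≢ f i
  u≢f i eq = miss (i , sym eq)

combine-suc : ∀ {J B} {j j′ : Fin J} {o o′ : Fin B} → suc (toℕ (combine j o)) ≡ toℕ (combine j′ o′) →
              (j ≡ j′ × suc (toℕ o) ≡ toℕ o′) ⊎ (suc (toℕ j) ≡ toℕ j′ × suc (toℕ o) ≡ B × toℕ o′ ≡ 0)
combine-suc {J} {B@(suc _)} {j} {j′} {o} {o′} eq with m≤n⇒m<n∨m≡n (Fin.toℕ<n o)
... | inj₁ 1+o<B with Fin.combine-injective j (fromℕ< 1+o<B) j′ o′ (Fin.toℕ-injective same)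
  where
  same : toℕ (combine j (fromℕ< 1+o<B)) ≡ toℕ (combine j′ o′)
  same = trans (Fin.toℕ-combine j (fromℕ< 1+o<B)) (trans (cong (λ x → B * toℕ j + x) (Fin.toℕ-fromℕ< 1+o<B))
           (trans (+-suc (B * toℕ j) (toℕ o)) (trans (cong suc (sym (Fin.toℕ-combine j o))) eq)))
...   | j≡j′ , 1+o≡o′ = inj₁ (j≡j′ , trans (sym (Fin.toℕ-fromℕ< 1+o<B)) (cong toℕ 1+o≡o′))
combine-suc {J} {B@(suc _)} {j} {j′} {o} {o′} eq | inj₂ 1+o≡B
  -- Among `suc J` blocks, the successor of the last index of block `j` is index 0 of block `suc j`,
  -- even when `j` is the final one of the `J` blocks.
  with Fin.combine-injective {suc J} (suc j) zero (inject₁ j′) o′ (Fin.toℕ-injective same)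
  where
  same : toℕ (combine {suc J} (suc j) (zero {_})) ≡ toℕ (combine (inject₁ j′) o′)
  same = begin
    toℕ (combine {suc J} {B} (suc j) zero)   ≡⟨ Fin.toℕ-combine {suc J} {B} (suc j) zero ⟩
    B * suc (toℕ j) + 0                      ≡⟨ +-identityʳ _ ⟩
    B * suc (toℕ j)                          ≡⟨ *-suc B (toℕ j) ⟩
    B + B * toℕ j                            ≡⟨ +-comm B _ ⟩
    B * toℕ j + B                            ≡⟨ cong (λ x → B * toℕ j + x) 1+o≡B ⟨
    B * toℕ j + suc (toℕ o)                  ≡⟨ +-suc _ (toℕ o) ⟩
    suc (B * toℕ j + toℕ o)                  ≡⟨ cong suc (Fin.toℕ-combine j o) ⟨
    suc (toℕ (combine j o))                  ≡⟨ eq ⟩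
    toℕ (combine j′ o′)                      ≡⟨ Fin.toℕ-combine j′ o′ ⟩
    B * toℕ j′ + toℕ o′                      ≡⟨ cong (λ x → B * x + toℕ o′) (Fin.toℕ-inject₁ j′) ⟨
    B * toℕ (inject₁ j′) + toℕ o′            ≡⟨ Fin.toℕ-combine (inject₁ j′) o′ ⟨
    toℕ (combine (inject₁ j′) o′)            ∎
    where open ≡-Reasoning
... | 1+j≡j′ , 0≡o′ = inj₂ (trans (cong toℕ 1+j≡j′) (Fin.toℕ-inject₁ j′) , 1+o≡B , sym (cong toℕ 0≡o′))

-- This prevents a copy of `G` from ending inside a connector, whose vertices have degree at most
-- two.
Branching : ∀ {m} → Graph m → Set
Branching G = ∀ i → ∃[ a ] ∃[ b ] a ≢ b × Adj G i a × Adj G i b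

-- Layered graphs joined by connectors

module Layered {R′ h M : ℕ} (T : ℕ → Fin h → Fin h → Fin M → Fin M)
               (T-involutive : ∀ ℓ a b v → T ℓ a b (T ℓ a b v) ≡ v) where

  open Items {R′} {h} {M} T T-involutive

  Site : Set
  Site = Fin R × Fin h × Fin M

  infix 4 _↗_
  _↗_ : Site → Site → Set
  (i , a , v) ↗ (i′ , b , w) = suc (toℕ i) ≡ toℕ i′ × w ≡ T (toℕ i) a b v

  Contains : ∀ {m} → Graph m → Set
  Contains {m} G = Σ[ y ∈ (Fin m → Site) ] Injective _≡_ _≡_ y × (∀ i j → Adj G i j → y i ↗ y j ⊎ y j ↗ y i)

  module Connected (J g′ : ℕ) where

    g : ℕ
    g = suc g′

    -- conn j o is the o-th vertex of a path of fresh vertices that leads from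
    -- the end of chunk j − 1 to the start of chunk j.
    data Y : Set where
      conn : Fin J → Fin g → Y
      site : Site → Y

    conn-injective : ∀ {j j′ o o′} → conn j o ≡ conn j′ o′ → j ≡ j′ × o ≡ o′
    conn-injective refl = refl , refl

    site-injective : ∀ {x x′} → site x ≡ site x′ → x ≡ x′
    site-injective refl = refl

    N : ℕ
    N = J * g + R * (h * M)

    code : Y → Fin N
    code (conn j o)         = join (J * g) _ (inj₁ (combine j o))
    code (site (i , a , v)) = join (J * g) _ (inj₂ (combine i (combine a v)))

    join-injective : ∀ m n {x y : Fin m ⊎ Fin n} → join m n x ≡ join m n y → x ≡ y
    join-injective m n {x} {y} eq = trans (sym (Fin.splitAt-join m n x)) (trans (cong (splitAt m) eq) (Fin.splitAt-join m n y))

    code-injective : Injective _≡_ _≡_ code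
    code-injective {conn j o} {conn j′ o′} eq
      with refl , refl ← Fin.combine-injective j o j′ o′ (Sum.inj₁-injective (join-injective (J * g) _ eq)) = refl
    code-injective {conn j o} {site _} eq with () ← join-injective (J * g) _ {inj₁ _} {inj₂ _} eq
    code-injective {site _} {conn j o} eq with () ← join-injective (J * g) _ {inj₂ _} {inj₁ _} eq
    code-injective {site (i , a , v)} {site (i′ , a′ , v′)} eq
      with refl , e ← Fin.combine-injective i (combine a v) i′ (combine a′ v′) (Sum.inj₂-injective (join-injective (J * g) _ {inj₂ _} {inj₂ _} eq))
      with refl , refl ← Fin.combine-injective a v a′ v′ e = refl

    module Edges (start end : Fin J → Fin (h * M)) where

      data _⟶_ : Y → Y → Set where
        layer : ∀ {x y} → x ↗ y → site x ⟶ site y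
        step  : ∀ {j o o′} → suc (toℕ o) ≡ toℕ o′ → conn j o ⟶ conn j o′
        exit  : ∀ {j o i a v} → suc (toℕ o) ≡ g → toℕ i ≡ 0 → combine a v ≡ start j → conn j o ⟶ site (i , a , v)
        enter : ∀ {j j′ o i a v} → suc (toℕ j) ≡ toℕ j′ → toℕ o ≡ 0 →
                suc (toℕ i) ≡ R → combine a v ≡ end j → site (i , a , v) ⟶ conn j′ o

      _—_ : Y → Y → Set
      x — y = x ⟶ y ⊎ y ⟶ x

      -- Edges are oriented along the path. A connector vertex has at most one edge in either
      -- direction, since `start` and `end` fix the sites to which a connector is attached.
      successor-unique : ∀ {j o y y′} → conn j o ⟶ y → conn j o ⟶ y′ → y ≡ y′
      successor-unique (step e) (step e′) = cong (conn _) (Fin.toℕ-injective (trans (sym e) e′))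
      successor-unique (step {o′ = o′} e) (exit e′ _ _) = contradiction (trans (sym e) e′) (<⇒≢ (Fin.toℕ<n o′))
      successor-unique (exit e _ _) (step {o′ = o′} e′) = contradiction (trans (sym e′) e) (<⇒≢ (Fin.toℕ<n o′))
      successor-unique (exit {a = a} {v} _ i≡0 e) (exit {a = a′} {v′} _ i′≡0 e′)
        with refl ← Fin.toℕ-injective (trans i≡0 (sym i′≡0))
        with refl , refl ← Fin.combine-injective a v a′ v′ (trans e (sym e′)) = refl

      predecessor-unique : ∀ {j o y y′} → y ⟶ conn j o → y′ ⟶ conn j o → y ≡ y′
      predecessor-unique (step e) (step e′) = cong (conn _) (Fin.toℕ-injective (suc-injective (trans e (sym e′))))
      predecessor-unique (step e) (enter _ o≡0 _ _) with () ← trans e o≡0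
      predecessor-unique (enter _ o≡0 _ _) (step e) with () ← trans e o≡0
      predecessor-unique (enter {a = a} {v} j≡ _ i≡ e) (enter {a = a′} {v′} j≡′ _ i≡′ e′)
        with refl ← Fin.toℕ-injective (suc-injective (trans i≡ (sym i≡′)))
        with refl ← Fin.toℕ-injective (suc-injective (trans j≡ (sym j≡′)))
        with refl , refl ← Fin.combine-injective a v a′ v′ (trans e (sym e′)) = refl

      module _ {m} (G : Graph m) (branching : Branching G)
               (m≤g′ : m ≤ g′)
               (y : Fin m → Y) (y-injective : Injective _≡_ _≡_ y) (y-adj : ∀ i j → Adj G i j → y i — y j) where

        Visits : Y → Set
        Visits x = ∃[ i ] y i ≡ x

        -- Of two distinct neighbours in the copy, at most one is the predecessor of the connector
        -- vertex, so one of them is its successor.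
        visits-next : ∀ {j o o′} → suc (toℕ o) ≡ toℕ o′ → Visits (conn j o) → Visits (conn j o′)
        visits-next 1+o≡o′ (i , yi≡) with branching i
        ... | a , b , a≢b , i~a , i~b with subst (_— y a) yi≡ (y-adj i a i~a) | subst (_— y b) yi≡ (y-adj i b i~b)
        ...   | inj₁ o⟶a | _        = a , successor-unique o⟶a (step 1+o≡o′)
        ...   | inj₂ _   | inj₁ o⟶b = b , successor-unique o⟶b (step 1+o≡o′)
        ...   | inj₂ a⟶o | inj₂ b⟶o = contradiction (y-injective (predecessor-unique a⟶o b⟶o)) a≢b

        visits-previous : ∀ {j o o′} → suc (toℕ o) ≡ toℕ o′ → Visits (conn j o′) → Visits (conn j o)
        visits-previous 1+o≡o′ (i , yi≡) with branching i
        ... | a , b , a≢b , i~a , i~b with subst (_— y a) yi≡ (y-adj i a i~a) | subst (_— y b) yi≡ (y-adj i b i~b)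
        ...   | inj₂ a⟶o | _        = a , predecessor-unique a⟶o (step 1+o≡o′)
        ...   | inj₁ _   | inj₂ b⟶o = b , predecessor-unique b⟶o (step 1+o≡o′)
        ...   | inj₁ o⟶a | inj₁ o⟶b = contradiction (y-injective (successor-unique o⟶a o⟶b)) a≢b

        -- A copy that meets a connector runs through all of it, but a connector has `g > m`
        -- vertices.
        no-connector : ∀ j o → ¬ Visits (conn j o)
        no-connector j o visit = contradiction (Fin.injective⇒≤ {f = proj₁ ∘ visits} visits-injective) (<⇒≱ (s≤s m≤g′))
          where
          visits : ∀ o → Visits (conn j o)
          -- The inner induction descends from `o` to the first vertex, the outer one ascends from
          -- there.
          visits = <-weakInduction (Visits ∘ conn j)
            (<-weakInduction (λ o → Visits (conn j o) → Visits (conn j zero)) id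
              (λ o down → down ∘ visits-previous (cong suc (Fin.toℕ-inject₁ o))) o visit)
            (λ o → visits-next (cong suc (Fin.toℕ-inject₁ o)))
          visits-injective : Injective _≡_ _≡_ (proj₁ ∘ visits)
          visits-injective {o} {o′} eq = proj₂ (conn-injective (trans (sym (proj₂ (visits o))) (trans (cong y eq) (proj₂ (visits o′)))))

        all-sites : ∀ i → ∃[ x ] y i ≡ site x
        all-sites i with y i in eq
        ... | conn j o = contradiction (i , eq) (no-connector j o)
        ... | site x   = x , refl

        contains : Contains G
        contains = proj₁ ∘ all-sites ,
          (λ {i} {j} eq → y-injective (trans (proj₂ (all-sites i)) (trans (cong site eq) (sym (proj₂ (all-sites j)))))) ,
          λ i j i~j → Sum.map layer⁻¹ layer⁻¹ (subst₂ _—_ (proj₂ (all-sites i)) (proj₂ (all-sites j)) (y-adj i j i~j))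
          where
          layer⁻¹ : ∀ {x x′} → site x ⟶ site x′ → x ↗ x′
          layer⁻¹ (layer x↗x′) = x↗x′

    ⟶-cong : ∀ {start end start′ end′} → (∀ j → start j ≡ start′ j) → (∀ j → end j ≡ end′ j) →
             ∀ {x y} → Edges._⟶_ start end x y → Edges._⟶_ start′ end′ x y
    ⟶-cong s≗ e≗ (Edges.layer x↗y)               = Edges.layer x↗y
    ⟶-cong s≗ e≗ (Edges.step 1+o≡o′)             = Edges.step 1+o≡o′
    ⟶-cong s≗ e≗ (Edges.exit full i≡0 av≡)       = Edges.exit full i≡0 (trans av≡ (s≗ _))
    ⟶-cong s≗ e≗ (Edges.enter 1+j≡k o≡0 1+i≡R av≡) = Edges.enter 1+j≡k o≡0 1+i≡R (trans av≡ (e≗ _))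

    module Labelling (xs : Vec Item J) (clash-free : ∀ j k → toℕ j < toℕ k → ¬ Clash (lookup xs k) (lookup xs j)) where

      start end : Fin J → Fin (h * M)
      start j = uncurry combine (at (lookup xs j) zero)
      end   j = uncurry combine (at (lookup xs j) (Fin.fromℕ R′))

      open Edges start end

      -- The positions of the path are cut into `J` blocks of length `g + R`, each a connector
      -- followed by its chunk.
      block : Fin J → Fin g ⊎ Fin R → Y
      block j (inj₁ o) = conn j o
      block j (inj₂ i) = site (i , at (lookup xs j) i)

      place : Fin J × Fin (g + R) → Y
      place (j , o) = block j (splitAt g o)

      label : Fin (J * (g + R)) → Y
      label u = place (remQuot (g + R) u)

      clash⇒≡ : ∀ j k → Clash (lookup xs j) (lookup xs k) → j ≡ k
      clash⇒≡ j k (i , same) with <-cmp (toℕ j) (toℕ k)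
      ... | tri< j<k _ _ = contradiction (i , sym same) (clash-free j k j<k)
      ... | tri≈ _ j≡k _ = Fin.toℕ-injective j≡k
      ... | tri> _ _ k<j = contradiction (i , same) (clash-free k j k<j)

      block-injective : ∀ {j k o o′} → block j o ≡ block k o′ → j ≡ k × o ≡ o′
      block-injective {o = inj₁ _} {inj₁ _} refl = refl , refl
      block-injective {j} {k} {inj₂ i} {inj₂ i′} eq with site-injective eq
      ... | e with cong proj₁ e
      ...   | refl = clash⇒≡ j k (i , cong proj₂ e) , refl

      label-injective : Injective _≡_ _≡_ label
      label-injective {u} {u′} eq with block-injective {o = splitAt g (proj₂ (remQuot {J} (g + R) u))} {splitAt g (proj₂ (remQuot {J} (g + R) u′))} eq
      ... | j≡k , o≡o′ = remQuot-injective {J} (g + R) (cong₂ _,_ j≡k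
              (trans (sym (Fin.join-splitAt g R _)) (trans (cong (join g R) o≡o′) (Fin.join-splitAt g R _))))

      toℕ-offset : Fin g ⊎ Fin R → ℕ
      toℕ-offset (inj₁ o) = toℕ o
      toℕ-offset (inj₂ i) = g + toℕ i

      toℕ-splitAt : ∀ o → toℕ o ≡ toℕ-offset (splitAt g o)
      toℕ-splitAt o with splitAt g o | Fin.join-splitAt g R o
      ... | inj₁ o′ | refl = Fin.toℕ-↑ˡ o′ R
      ... | inj₂ i  | refl = Fin.toℕ-↑ʳ g i

      block-⟶ : ∀ j o o′ → suc (toℕ-offset o) ≡ toℕ-offset o′ → block j o ⟶ block j o′
      block-⟶ j (inj₁ o) (inj₁ o′) eq = step eq
      block-⟶ j (inj₁ o) (inj₂ i)  eq with i
      ... | zero  = exit (trans eq (+-identityʳ g)) refl refl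
      ... | suc i = contradiction (≤-trans (m≤m+n (suc g) (toℕ i)) (≤-reflexive (sym (trans eq (+-suc g (toℕ i)))))) (<⇒≱ (s≤s (Fin.toℕ<n o)))
      block-⟶ j (inj₂ i) (inj₁ o)  eq = contradiction (≤-trans (m≤m+n g (toℕ i)) (≤-trans (n≤1+n _) (≤-reflexive eq))) (<⇒≱ (Fin.toℕ<n o))
      block-⟶ j (inj₂ i) (inj₂ i′) eq = layer (1+i≡i′ , val-step 0 (proj₁ (lookup xs j)) (proj₂ (lookup xs j)) i i′ 1+i≡i′)
        where
        1+i≡i′ : suc (toℕ i) ≡ toℕ i′
        1+i≡i′ = +-cancelˡ-≡ g _ _ (trans (+-suc g (toℕ i)) eq)

      block-enter : ∀ j k o o′ → suc (toℕ j) ≡ toℕ k → suc (toℕ-offset o) ≡ g + R → toℕ-offset o′ ≡ 0 → block j o ⟶ block k o′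
      block-enter j k (inj₁ o) o′ _ full _ =
        contradiction (subst (_≤ g) full (Fin.toℕ<n o)) (m+1+n≰m g)
      block-enter j k (inj₂ i) (inj₂ _) _ _ ()
      block-enter j k (inj₂ i) (inj₁ o) 1+j≡k full o≡0 = enter 1+j≡k o≡0 1+i≡R
          (cong (λ i → uncurry combine (at (lookup xs j) i)) (Fin.toℕ-injective (trans (suc-injective 1+i≡R) (sym (Fin.toℕ-fromℕ R′)))))
        where
        1+i≡R : suc (toℕ i) ≡ R
        1+i≡R = +-cancelˡ-≡ g _ _ (trans (+-suc g (toℕ i)) full)

      place-⟶ : ∀ j k o o′ → suc (toℕ (combine j o)) ≡ toℕ (combine k o′) → place (j , o) ⟶ place (k , o′)
      place-⟶ j k o o′ eq with combine-suc {j = j} {k} {o} {o′} eq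
      ... | inj₁ (refl , 1+o≡o′) = block-⟶ j _ _
              (trans (cong suc (sym (toℕ-splitAt o))) (trans 1+o≡o′ (toℕ-splitAt o′)))
      ... | inj₂ (1+j≡k , full , o′≡0) = block-enter j k _ _ 1+j≡k
              (trans (cong suc (sym (toℕ-splitAt o))) full) (trans (sym (toℕ-splitAt o′)) o′≡0)

      label-⟶ : ∀ u u′ → suc (toℕ u) ≡ toℕ u′ → label u ⟶ label u′
      label-⟶ u u′ 1+u≡u′ = place-⟶ _ _ _ _ (subst₂ (λ x y → suc (toℕ x) ≡ toℕ y)
        (sym (Fin.combine-remQuot {J} (g + R) u)) (sym (Fin.combine-remQuot {J} (g + R) u′)) 1+u≡u′)

  -- Recovering paths and choices from embeddings

  module _ {m} (G : Graph m) (branching : Branching G) (¬contains : ¬ Contains G)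
           {J′ n k : ℕ} (room : J′ * (R * h ^ R′) + h ^ R ≤ h ^ R * M)
           (J′B≤n : J′ * (suc m + R) ≤ n) (n≤JB : n ≤ suc J′ * (suc m + R)) (family : Family n G k) where

    private
      J Q : ℕ
      J = suc J′
      Q = h ^ R

    open Connected J m

    private
      path : Fin k → Fin n → Fin n
      path i = to (proj₁ family i)

      path-injective : ∀ i → Injective _≡_ _≡_ (path i)
      path-injective i = injective (proj₁ family i)

      rank : Fin k → Fin n → Fin n
      rank i u = proj₁ (injective⇒surjective (path-injective i) u)

      path-rank : ∀ i u → path i (rank i u) ≡ u
      path-rank i u = proj₂ (injective⇒surjective (path-injective i) u)

      rank-path : ∀ i u → rank i (path i u) ≡ u
      rank-path i u = path-injective i (path-rank i (path i u))

      position : Fin n → Fin (J * (g + R))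
      position u = inject≤ u n≤JB

    module _ {Q′} (Q≡ : Q ≡ suc Q′) where
      open Greedy _≟Item_ {Q′ = Q′} {r = J′} Clash conflicts listed items items-injective
        (subst (λ q → J′ * (R * h ^ R′) + q ≤ h ^ R * M) Q≡ room)

      chunks : Vec (Fin (suc Q′)) J′ → Vec Item J
      chunks = greedy J′ refl []

      open module L (cs : Vec (Fin (suc Q′)) J′) = Labelling (chunks cs) (greedy-clash-free J′ refl [] cs) using (label; start; end)

      embedding : Fin k → Vec (Fin (suc Q′)) J′ → Fin n → Y
      embedding i cs u = label cs (position (rank i u))

      embedding-injective : ∀ i cs → Injective _≡_ _≡_ (embedding i cs)
      embedding-injective i cs {u} {u′} eq = trans (sym (path-rank i u)) (trans (cong (path i)
        (Fin.inject≤-injective _ _ _ _ (L.label-injective cs eq))) (path-rank i u′))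

      embedding-adj : ∀ i cs u v → Adj (image (proj₁ family i)) u v →
                      Edges._—_ (start cs) (end cs) (embedding i cs u) (embedding i cs v)
      embedding-adj i cs _ _ (a , b , a~b , refl , refl) =
        subst₂ (λ x y → Edges._—_ (start cs) (end cs) (label cs (position x)) (label cs (position y)))
          (sym (rank-path i a)) (sym (rank-path i b)) (Sum.map (along a b) (along b a) a~b)
        where
        along : ∀ a b → PathStep a b → Edges._⟶_ (start cs) (end cs) (label cs (position a)) (label cs (position b))
        along a b 1+a≡b = L.label-⟶ cs _ _
          (trans (cong suc (Fin.toℕ-inject≤ a n≤JB)) (trans 1+a≡b (sym (Fin.toℕ-inject≤ b n≤JB))))

      module _ {i i′ cs cs′} (same-embedding : ∀ u → embedding i cs u ≡ embedding i′ cs′ u)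
               (same-start : ∀ j → start cs j ≡ start cs′ j) (same-end : ∀ j → end cs j ≡ end cs′ j) where

        -- If `i ≢ i′`, the copy of `G` in the union of the two paths would be mapped into one host
        -- graph, as both choices have the same chunk ends. Being disjoint from the connectors, it
        -- would lie among the sites.
        same-path : i ≡ i′
        same-path with i Fin.≟ i′
        ... | yes i≡i′ = i≡i′
        ... | no  i≢i′ = contradiction
          (Edges.contains (start cs) (end cs) G branching ≤-refl (embedding i cs ∘ to f)
            (injective f ∘ embedding-injective i cs) adj)
          ¬contains
          where
          f : G ↪ (image (proj₁ family i) ∪ image (proj₁ family i′))
          f = proj₂ (proj₂ family i i′ i≢i′)
          adj : ∀ a b → Adj G a b → Edges._—_ (start cs) (end cs) (embedding i cs (to f a)) (embedding i cs (to f b))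
          adj a b a~b with preserves f a~b
          ... | inj₁ e = embedding-adj i cs _ _ e
          ... | inj₂ e = subst₂ (Edges._—_ (start cs) (end cs)) (sym (same-embedding _)) (sym (same-embedding _))
                (Sum.map (⟶-cong (sym ∘ same-start) (sym ∘ same-end)) (⟶-cong (sym ∘ same-start) (sym ∘ same-end))
                         (embedding-adj i′ cs′ _ _ e))

        same-labels : ∀ u → label cs (position u) ≡ label cs′ (position u)
        same-labels u with refl ← same-path =
          subst (λ x → label cs (position x) ≡ label cs′ (position x)) (rank-path i u) (same-embedding (path i u))

        -- The first `J′` blocks are complete, because `J′ * (g + R) ≤ n`, so each of their
        -- positions is occupied by a vertex of the path.
        same-block : ∀ (j : Fin J′) i → L.block cs (inject₁ j) (inj₂ i) ≡ L.block cs′ (inject₁ j) (inj₂ i)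
        same-block j i = subst₂ _≡_ (label≡ cs) (label≡ cs′) (same-labels u)
          where
          target : Fin (J * (g + R))
          target = combine (inject₁ j) (g ↑ʳ i)
          target<n : toℕ target < n
          target<n = <-≤-trans (subst₂ _<_
              (trans (Fin.toℕ-combine j (g ↑ʳ i)) (sym (trans (Fin.toℕ-combine (inject₁ j) (g ↑ʳ i))
                (cong (λ x → (g + R) * x + toℕ (g ↑ʳ i)) (Fin.toℕ-inject₁ j)))))
              refl (Fin.toℕ<n (combine j (g ↑ʳ i)))) J′B≤n
          u : Fin n
          u = fromℕ< target<n
          position-u : position u ≡ target
          position-u = Fin.toℕ-injective (trans (Fin.toℕ-inject≤ u n≤JB) (Fin.toℕ-fromℕ< target<n))
          label≡ : ∀ cs → label cs (position u) ≡ L.block cs (inject₁ j) (inj₂ i)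
          label≡ cs = trans (cong (label cs) position-u)
            (trans (cong (λ (j , o) → L.block cs j (splitAt g o)) (Fin.remQuot-combine (inject₁ j) (g ↑ʳ i)))
                   (cong (L.block cs (inject₁ j)) (Fin.splitAt-↑ʳ g R i)))

        same-codes : cs ≡ cs′
        same-codes = greedy-injective J′ refl [] cs cs′ λ j →
          at-injective _ _ λ i → cong proj₂ (site-injective (same-block j i))

      private
        X : ℕ
        X = h * M

        Target : ℕ
        Target = N ^ n * (X ^ J * X ^ J)

        -- The starts and ends of the chunks are recorded besides the embedding, because they decide
        -- which connector edges the host graph has.
        encode : Fin (k * suc Q′ ^ J′) → Fin Target
        encode z =
          let i , c = remQuot (suc Q′ ^ J′) z
              cs = tabulate (finToFun c)
          in  combine (funToFin (code ∘ embedding i cs)) (combine (funToFin (start cs)) (funToFin (end cs)))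

      encode-injective : Injective _≡_ _≡_ encode
      encode-injective {z} {z′} eq = remQuot-injective {k} (suc Q′ ^ J′)
        (cong₂ _,_ (same-path same-emb same-s same-e) (finToFun-injective {J′} {suc Q′} λ j →
          trans (sym (lookup∘tabulate (codes z) j))
            (trans (cong (λ cs → lookup cs j) (same-codes {i = path-of z} {path-of z′} same-emb same-s same-e))
              (lookup∘tabulate (codes z′) j))))
        where
        path-of : Fin (k * suc Q′ ^ J′) → Fin k
        path-of z = proj₁ (remQuot {k} (suc Q′ ^ J′) z)
        codes : Fin (k * suc Q′ ^ J′) → Fin J′ → Fin (suc Q′)
        codes z = finToFun (proj₂ (remQuot {k} (suc Q′ ^ J′) z))
        eqs : _ × _
        eqs = Fin.combine-injective _ _ _ _ eq
        eqs′ : _ × _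
        eqs′ = Fin.combine-injective _ _ _ _ (proj₂ eqs)
        same-emb : ∀ u → embedding (path-of z) (tabulate (codes z)) u ≡ embedding (path-of z′) (tabulate (codes z′)) u
        same-emb u = code-injective (funToFin-injective (proj₁ eqs) u)
        same-s : ∀ j → start (tabulate (codes z)) j ≡ start (tabulate (codes z′)) j
        same-s = funToFin-injective (proj₁ eqs′)
        same-e : ∀ j → end (tabulate (codes z)) j ≡ end (tabulate (codes z′)) j
        same-e = funToFin-injective (proj₂ eqs′)

      count : k * suc Q′ ^ J′ ≤ Target
      count = Fin.injective⇒≤ encode-injective

-- The graphs of f₆, f₈ and f₁₀, in layers of alternating type

even : ℕ → Bool
even zero    = true
even (suc n) = not (even n)

module _ {p} (p-prime : Prime p) where

  private instance
    p≢0 : NonZero p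
    p≢0 = prime⇒nonZero p-prime

  complement : ℕ → Fin p → Fin p
  complement c v = (c + (p ∸ toℕ v)) mod p

  complement-sum : ∀ c v → + p ∣ℤ + (toℕ v + toℕ (complement c v)) ℤ.- + c
  complement-sum c v = ℤ∣.divides (1ℤ ℤ.- + (x ℕ./ p)) (begin
    + (toℕ v + toℕ (x mod p)) ℤ.- + c                       ≡⟨ cong (λ y → + (toℕ v + y) ℤ.- + c) (Fin.toℕ-fromℕ< (m%n<n x p)) ⟩
    + (toℕ v + x % p) ℤ.- + c                               ≡⟨ cong (λ y → y ℤ.- + c) (ℤ.pos-+ (toℕ v) (x % p)) ⟩
    + toℕ v ℤ.+ + (x % p) ℤ.- + c                           ≡⟨ cong (λ y → + toℕ v ℤ.+ y ℤ.- + c) remainder ⟩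
    + toℕ v ℤ.+ (+ c ℤ.+ (+ p ℤ.- + toℕ v) ℤ.- + (x ℕ./ p) ℤ.* + p) ℤ.- + c
                                                            ≡⟨ regroup (+ toℕ v) (+ c) (+ p) (+ (x ℕ./ p)) ⟩
    (1ℤ ℤ.- + (x ℕ./ p)) ℤ.* + p                              ∎)
    where
    open ≡-Reasoning
    x : ℕ
    x = c + (p ∸ toℕ v)
    regroup : ∀ v c p q → v ℤ.+ (c ℤ.+ (p ℤ.- v) ℤ.- q ℤ.* p) ℤ.- c ≡ (1ℤ ℤ.- q) ℤ.* p
    regroup = ℤ-solve-∀
    cancel : ∀ r b → r ≡ r ℤ.+ b ℤ.- b
    cancel = ℤ-solve-∀
    x≡ : + x ≡ + (x % p) ℤ.+ + (x ℕ./ p) ℤ.* + p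
    x≡ = trans (cong +_ (m≡m%n+[m/n]*n x p)) (trans (ℤ.pos-+ (x % p) _) (cong (λ y → + (x % p) ℤ.+ y) (ℤ.pos-* (x ℕ./ p) p)))
    x≡′ : + x ≡ + c ℤ.+ (+ p ℤ.- + toℕ v)
    x≡′ = trans (ℤ.pos-+ c _) (cong (λ y → + c ℤ.+ y) (trans (sym (ℤ.⊖-≥ (<⇒≤ (Fin.toℕ<n v)))) (sym (ℤ.m-n≡m⊖n p (toℕ v)))))
    remainder : + (x % p) ≡ + c ℤ.+ (+ p ℤ.- + toℕ v) ℤ.- + (x ℕ./ p) ℤ.* + p
    remainder = trans (cancel (+ (x % p)) (+ (x ℕ./ p) ℤ.* + p)) (cong (λ y → y ℤ.- + (x ℕ./ p) ℤ.* + p) (trans (sym x≡) x≡′))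

  complement-involutive : ∀ c v → complement c (complement c v) ≡ v
  complement-involutive c v = Fin.toℕ-injective (∣-difference⇒≡ p-prime (Fin.toℕ<n _) (Fin.toℕ<n _)
    (residues (toℕ w) (toℕ (complement c w)) (toℕ v) (+ c) (complement-sum c w)
      (subst (λ x → + p ∣ℤ + x ℤ.- + c) (+-comm (toℕ v) (toℕ w)) (complement-sum c v))))
    where
    w : Fin p
    w = complement c v

module _ {p κ} (p-prime : Prime p) (f : ℕ → ℕ → Vec ℕ κ) (R′ h : ℕ) (Rh≤p : suc R′ * h ≤ p) where

  vec : Fin (p ^ κ) → Vec (Fin p) κ
  vec = tabulate ∘ finToFun

  vec-injective : Injective _≡_ _≡_ vec
  vec-injective {v} {w} eq = finToFun-injective {κ} {p} λ j →
    trans (sym (lookup∘tabulate (finToFun v) j)) (trans (cong (λ x → lookup x j) eq) (lookup∘tabulate (finToFun w) j))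

  vec-surjective : ∀ (x : Fin κ → Fin p) j → lookup (vec (funToFin x)) j ≡ x j
  vec-surjective x j = trans (lookup∘tabulate (finToFun (funToFin x)) j) (Fin.finToFun-funToFin x j)

  -- Distinct layers use disjoint intervals of `h` colours, which fit below `p` because
  -- `suc R′ * h ≤ p`.
  colour : ℕ → Fin h → ℕ
  colour ℓ a = h * ℓ + toℕ a

  -- Even layers hold points and odd layers lines, so the arguments of `f` are swapped on a step out
  -- of an odd layer.
  oriented : Bool → ℕ → ℕ → Vec ℕ κ
  oriented b s t = if b then f s t else f t s

  voltage : ℕ → Fin h → Fin h → Vec ℕ κ
  voltage ℓ a b = oriented (even ℓ) (colour ℓ a) (colour (suc ℓ) b)

  T : ℕ → Fin h → Fin h → Fin (p ^ κ) → Fin (p ^ κ)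
  T ℓ a b v = funToFin λ j → complement p-prime (lookup (voltage ℓ a b) j) (lookup (vec v) j)

  lookup-T : ∀ ℓ a b v j → lookup (vec (T ℓ a b v)) j ≡ complement p-prime (lookup (voltage ℓ a b) j) (lookup (vec v) j)
  lookup-T ℓ a b v = vec-surjective _

  T-involutive : ∀ ℓ a b v → T ℓ a b (T ℓ a b v) ≡ v
  T-involutive ℓ a b v = vec-injective (lookup-injective λ j →
    trans (lookup-T ℓ a b (T ℓ a b v) j)
      (trans (cong (complement p-prime _) (lookup-T ℓ a b v j)) (complement-involutive p-prime _ _)))

  open Layered {R′} {h} {p ^ κ} T T-involutive

  vertex : Site → Vertex p κ
  vertex (i , a , v) = inject≤ (combine i a) Rh≤p , vec v

  vertex-injective : Injective _≡_ _≡_ vertex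
  vertex-injective {i , a , v} {i′ , a′ , v′} eq
    with refl , refl ← Fin.combine-injective i a i′ a′ (Fin.inject≤-injective Rh≤p Rh≤p _ _ (cong proj₁ eq))
    = cong (λ v → i , a , v) (vec-injective (cong proj₂ eq))

  colour-vertex : ∀ i a v → toℕ (proj₁ (vertex (i , a , v))) ≡ colour (toℕ i) a
  colour-vertex i a v = trans (Fin.toℕ-inject≤ (combine i a) Rh≤p) (Fin.toℕ-combine i a)

  isPoint : Site → Bool
  isPoint (i , _) = even (toℕ i)

  ↗-sum : ∀ {i i′ a a′ v v′} → (i , a , v) ↗ (i′ , a′ , v′) → ∀ j →
          + p ∣ℤ + (toℕ (lookup (vec v) j) + toℕ (lookup (vec v′) j)) ℤ.- + lookup (voltage (toℕ i) a a′) j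
  ↗-sum {i} {i′} {a} {a′} {v} (_ , refl) j =
    subst (λ w → + p ∣ℤ + (toℕ (lookup (vec v) j) + toℕ w) ℤ.- + lookup (voltage (toℕ i) a a′) j)
      (sym (lookup-T (toℕ i) a a′ v j)) (complement-sum p-prime (lookup (voltage (toℕ i) a a′) j) (lookup (vec v) j))

  colour-next : ∀ {i i′ : Fin (suc R′)} a v → suc (toℕ i) ≡ toℕ i′ → colour (suc (toℕ i)) a ≡ toℕ (proj₁ (vertex (i′ , a , v)))
  colour-next {i} {i′} a v 1+i≡i′ = trans (cong (λ ℓ → colour ℓ a) 1+i≡i′) (sym (colour-vertex i′ a v))

  ↗-incident : ∀ {x y} → x ↗ y → isPoint x ≡ true → Incident f (vertex x) (vertex y)
  ↗-incident {i , a , v} {i′ , a′ , v′} x↗y@(1+i≡i′ , _) x-point j =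
    subst (λ c → + p ∣ℤ + (toℕ (lookup (vec v) j) + toℕ (lookup (vec v′) j)) ℤ.- + lookup c j)
      (trans (cong (λ b → oriented b (colour (toℕ i) a) (colour (suc (toℕ i)) a′)) x-point)
             (cong₂ f (sym (colour-vertex i a v)) (colour-next a′ v′ 1+i≡i′)))
      (↗-sum x↗y j)

  ↗-incident′ : ∀ {x y} → x ↗ y → isPoint x ≡ false → Incident f (vertex y) (vertex x)
  ↗-incident′ {i , a , v} {i′ , a′ , v′} x↗y@(1+i≡i′ , _) x-line j =
    subst₂ (λ s c → + p ∣ℤ + s ℤ.- + lookup c j) (+-comm (toℕ (lookup (vec v) j)) _)
      (trans (cong (λ b → oriented b (colour (toℕ i) a) (colour (suc (toℕ i)) a′)) x-line)
             (cong₂ f (colour-next a′ v′ 1+i≡i′) (sym (colour-vertex i a v))))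
      (↗-sum x↗y j)

  ↗-isPoint : ∀ {x y} → x ↗ y → isPoint y ≡ not (isPoint x)
  ↗-isPoint (1+i≡i′ , _) = cong even (sym 1+i≡i′)

  infix 4 _~_
  _~_ : Site → Site → Set
  x ~ y = x ↗ y ⊎ y ↗ x

  ~-isPoint : ∀ {x y} → x ~ y → isPoint y ≡ not (isPoint x)
  ~-isPoint (inj₁ x↗y) = ↗-isPoint x↗y
  ~-isPoint (inj₂ y↗x) = trans (sym (Bool.not-involutive _)) (cong not (sym (↗-isPoint y↗x)))

  ~-incident : ∀ {x y} → x ~ y → isPoint x ≡ true → Incident f (vertex x) (vertex y)
  ~-incident (inj₁ x↗y) x-point = ↗-incident x↗y x-point
  ~-incident {x} {y} x~y@(inj₂ y↗x) x-point = ↗-incident′ y↗x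
    (trans (~-isPoint {x} {y} x~y) (cong not x-point))

-- Even cycles in the layered graph as closed walks

index : (m l r : ℕ) .{{_ : NonZero m}} → Fin l → Fin m
index m l r i = (toℕ i + toℕ i + r) mod m

-- The cycle vertices `2i + r` become the lines and `2i + r + 1` the points of the walk. For given
-- `m`, `l` and `r` this is a finite check, done by evaluation.
Alternates : (m l r : ℕ) {3≤m : True (3 ≤? m)} .{{_ : NonZero m}} .{{_ : NonZero l}} → Set
Alternates m l r {3≤m} = ∀ i →
  Adj (C m {3≤m}) (pt i) (ln i) × Adj (C m {3≤m}) (pt i) (ln (next i)) ×
  pt i ≢ pt (next i) × ln i ≢ ln (next i) × even (toℕ (pt i)) ≡ not (even r)
  where
  pt ln : Fin l → Fin m
  pt = index m l (suc r)
  ln = index m l r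

alternates? : ∀ m l r {3≤m : True (3 ≤? m)} .{{_ : NonZero m}} .{{_ : NonZero l}} → Dec (Alternates m l r {3≤m})
alternates? m l r {3≤m} = Fin.all? λ i →
  adj? (C m {3≤m}) _ _ ×-dec adj? (C m {3≤m}) _ _ ×-dec ¬? (_ Fin.≟ _) ×-dec ¬? (_ Fin.≟ _) ×-dec (_ Bool.≟ _)

branching? : ∀ {m} (G : Graph m) → Dec (Branching G)
branching? G = Fin.all? λ i → Fin.any? λ a → Fin.any? λ b → ¬? (a Fin.≟ b) ×-dec adj? G i a ×-dec adj? G i b

module _ {p κ} (p-prime : Prime p) (f : ℕ → ℕ → Vec ℕ κ) (R′ h : ℕ) (Rh≤p : suc R′ * h ≤ p) where

  open Layered {R′} {h} {p ^ κ} (T p-prime f R′ h Rh≤p) (T-involutive p-prime f R′ h Rh≤p)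

  module _ {m′} {3≤m : True (3 ≤? suc m′)} (contained : Contains (C (suc m′) {3≤m})) where

    private
      y : Fin (suc m′) → Site
      y = proj₁ contained
      y-injective : Injective _≡_ _≡_ y
      y-injective = proj₁ (proj₂ contained)
      y-adj : ∀ i j → Adj (C (suc m′) {3≤m}) i j → y i ↗ y j ⊎ y j ↗ y i
      y-adj = proj₂ (proj₂ contained)
      point? : Fin (suc m′) → Bool
      point? i = isPoint p-prime f R′ h Rh≤p (y i)

    -- Layers, hence points and lines, alternate along the cycle.
    point?-parity : ∀ i → point? i ≡ (if even (toℕ i) then point? zero else not (point? zero))
    point?-parity = <-weakInduction _ refl λ i ih →
      trans (~-isPoint p-prime f R′ h Rh≤p (y-adj (inject₁ i) (suc i) (inj₁ (inj₁ (cong suc (Fin.toℕ-inject₁ i))))))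
        (trans (cong not ih) (trans (Bool.if-float not (even (toℕ (inject₁ i))))
          (trans (flip (even (toℕ (inject₁ i)))) (cong (λ n → if not (even n) then point? zero else not (point? zero)) (Fin.toℕ-inject₁ i)))))
      where
      flip : ∀ e → (if e then not (point? zero) else not (not (point? zero))) ≡ (if not e then point? zero else not (point? zero))
      flip true  = refl
      flip false = Bool.not-involutive _

    closedWalk-from : ∀ l r .{{_ : NonZero l}} → Alternates (suc m′) l r {3≤m} →
                      (∀ i → even (toℕ i) ≡ not (even r) → point? i ≡ true) → ClosedWalk {p} f l
    closedWalk-from l r alt points = record
      { point         = vertex p-prime f R′ h Rh≤p ∘ y ∘ index (suc m′) l (suc r)
      ; line          = vertex p-prime f R′ h Rh≤p ∘ y ∘ index (suc m′) l r
      ; incident      = λ i → let a , _ , _ , _ , e = alt i in ~-incident p-prime f R′ h Rh≤p (y-adj _ _ a) (points _ e)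
      ; incident-next = λ i → let _ , a , _ , _ , e = alt i in ~-incident p-prime f R′ h Rh≤p (y-adj _ _ a) (points _ e)
      ; point-≢       = λ i → let _ , _ , pt≢ , _ = alt i in pt≢ ∘ y-injective ∘ vertex-injective p-prime f R′ h Rh≤p
      ; line-≢        = λ i → let _ , _ , _ , ln≢ , _ = alt i in ln≢ ∘ y-injective ∘ vertex-injective p-prime f R′ h Rh≤p
      }

    -- Vertex 0 of the cycle may be a line or a point; the offset is 0 in the first case and 1 in
    -- the second.
    closedWalk : ∀ l .{{_ : NonZero l}} → Alternates (suc m′) l 0 {3≤m} → Alternates (suc m′) l 1 {3≤m} → ClosedWalk {p} f l
    closedWalk l alt₀ alt₁ with point? zero in start
    ... | false = closedWalk-from l 0 alt₀ λ i odd  → trans (point?-parity i) (cong₂ (λ e b → if e then b else not b) odd start)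
    ... | true  = closedWalk-from l 1 alt₁ λ i even → trans (point?-parity i) (cong₂ (λ e b → if e then b else not b) even start)

no-C₆ : ∀ {p} (p-prime : Prime p) R′ h (Rh≤p : suc R′ * h ≤ p) →
        ¬ Layered.Contains (T p-prime f₆ R′ h Rh≤p) (T-involutive p-prime f₆ R′ h Rh≤p) (C 6)
no-C₆ p-prime R′ h Rh≤p c = no-hexagon p-prime (closedWalk p-prime f₆ R′ h Rh≤p c 3
  (toWitness {a? = alternates? 6 3 0} _) (toWitness {a? = alternates? 6 3 1} _))

no-C₈ : ∀ {p} (p-prime : Prime p) R′ h (Rh≤p : suc R′ * h ≤ p) → 2 < p →
        ¬ Layered.Contains (T p-prime f₈ R′ h Rh≤p) (T-involutive p-prime f₈ R′ h Rh≤p) (C 8)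
no-C₈ p-prime R′ h Rh≤p 2<p c = no-octagon p-prime 2<p (closedWalk p-prime f₈ R′ h Rh≤p c 4
  (toWitness {a? = alternates? 8 4 0} _) (toWitness {a? = alternates? 8 4 1} _))

no-C₁₀ : ∀ {p} (p-prime : Prime p) R′ h (Rh≤p : suc R′ * h ≤ p) →
         ¬ Layered.Contains (T p-prime f₁₀ R′ h Rh≤p) (T-involutive p-prime f₁₀ R′ h Rh≤p) (C 10)
no-C₁₀ p-prime R′ h Rh≤p c = no-decagon p-prime (closedWalk p-prime f₁₀ R′ h Rh≤p c 5
  (toWitness {a? = alternates? 10 5 0} _) (toWitness {a? = alternates? 10 5 1} _))

branching₆ : Branching (C 6)
branching₆ = toWitness {a? = branching? (C 6)} _

branching₈ : Branching (C 8)
branching₈ = toWitness {a? = branching? (C 8)} _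

branching₁₀ : Branching (C 10)
branching₁₀ = toWitness {a? = branching? (C 10)} _

-- Asymptotics

m<2^m : ∀ m → m < 2 ^ m
m<2^m zero    = s≤s z≤n
m<2^m (suc m) = ≤-trans (+-mono-≤ (m^n>0 2 m) (m<2^m m)) (+-monoʳ-≤ (2 ^ m) (m≤m+n (2 ^ m) 0))

log₂ : ∀ n .{{_ : NonZero n}} → ∃[ ν ] 2 ^ ν ≤ n × n < 2 ^ suc ν
log₂ (suc zero) = 0 , s≤s z≤n , s≤s (s≤s z≤n)
log₂ (suc n@(suc _)) with log₂ n
... | ν , 2^ν≤n , n<2^1+ν with suc n <? 2 ^ suc ν
...   | yes 1+n< = ν , m≤n⇒m≤1+n 2^ν≤n , 1+n<
...   | no  1+n≮ = suc ν , ≮⇒≥ 1+n≮ , ≤-<-trans n<2^1+ν (^-monoʳ-< 2 (s≤s (s≤s z≤n)) (n<1+n (suc ν)))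

2^-cancel-< : ∀ {a b} → 2 ^ a < 2 ^ b → a < b
2^-cancel-< 2^a<2^b = ≰⇒> λ b≤a → <⇒≱ 2^a<2^b (^-monoʳ-≤ 2 b≤a)

n<[1+n/B]*B : ∀ n B .{{_ : NonZero B}} → n < suc (n ℕ./ B) * B
n<[1+n/B]*B n B = ≤-trans (s≤s (≤-reflexive (m≡m%n+[m/n]*n n B))) (+-monoˡ-≤ (n ℕ./ B * B) (m%n<n n B))

^-cancelʳ-≤ : ∀ {a b} d .{{_ : NonZero d}} → a ^ d ≤ b ^ d → a ≤ b
^-cancelʳ-≤ d a^d≤b^d = ≮⇒≥ λ b<a → <⇒≱ (^-monoˡ-< d b<a) a^d≤b^d

*-^-distrib : ∀ a b d → (a * b) ^ d ≡ a ^ d * b ^ d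
*-^-distrib a b zero    = refl
*-^-distrib a b (suc d) = trans (cong (a * b *_) (*-^-distrib a b d)) (regroup a b (a ^ d) (b ^ d))
  where
  regroup : ∀ a b x y → a * b * (x * y) ≡ a * x * (b * y)
  regroup = solve-∀

2^-quotient : ∀ k d {x y z} → k * 2 ^ x ≤ 2 ^ y → d * y ≤ d * x + z → k ^ d ≤ 2 ^ z
2^-quotient k d {x} {y} {z} k2^x≤2^y dy≤ = *-cancelʳ-≤ (k ^ d) (2 ^ z) (2 ^ (x * d)) {{m^n≢0 2 (x * d)}} (begin
  k ^ d * 2 ^ (x * d)      ≡⟨ cong (k ^ d *_) (^-*-assoc 2 x d) ⟨
  k ^ d * (2 ^ x) ^ d      ≡⟨ *-^-distrib k (2 ^ x) d ⟨
  (k * 2 ^ x) ^ d          ≤⟨ ^-monoˡ-≤ d k2^x≤2^y ⟩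
  (2 ^ y) ^ d              ≡⟨ ^-*-assoc 2 y d ⟩
  2 ^ (y * d)              ≤⟨ ^-monoʳ-≤ 2 (≤-trans (≤-reflexive (*-comm y d)) dy≤) ⟩
  2 ^ (d * x + z)          ≡⟨ cong (2 ^_) (trans (+-comm (d * x) z) (cong (λ x → z + x) (*-comm d x))) ⟩
  2 ^ (z + x * d)          ≡⟨ ^-distribˡ-+-* 2 z (x * d) ⟩
  2 ^ z * 2 ^ (x * d)      ∎)
  where open ≤-Reasoning

-- This is the hypothesis of `prime-between` for `s = u + 4y`. As `u` is at most linear in `y` for
-- fixed `c`, the left side is essentially `2 ^ u` times a quadratic polynomial, which `(2 ^ y) ^ 4`
-- exceeds.
polynomial<exponential : ∀ c y u ν .{{_ : NonZero c}} → 6 * c ≤ y → ν ≤ c * suc y → u ≤ 2 * ν → suc (4 * y) ≤ ν →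
                         suc (u * 2 ^ u * suc (u + 4 * y)) < 2 ^ (u + 4 * y)
polynomial<exponential c y u ν 6c≤y ν≤ u≤2ν 4y<ν = begin-strict
  suc (u * 2 ^ u * suc (u + 4 * y))         ≡⟨ cong suc (regroup u (2 ^ u) y) ⟩
  suc (2 ^ u * (u * (u + suc (4 * y))))     <⟨ s≤s (≤-refl) ⟩
  2 + 2 ^ u * (u * (u + suc (4 * y)))       ≤⟨ +-monoˡ-≤ _ (*-monoʳ-≤ 2 (m^n>0 2 u)) ⟩
  2 * 2 ^ u + 2 ^ u * (u * (u + suc (4 * y)))
                                            ≡⟨ regroup₂ (2 ^ u) (u * (u + suc (4 * y))) ⟩
  2 ^ u * (2 + u * (u + suc (4 * y)))       ≤⟨ *-monoʳ-≤ (2 ^ u) (≤-trans bound (^-monoˡ-≤ 4 (<⇒≤ (m<2^m y)))) ⟩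
  2 ^ u * (2 ^ y) ^ 4                       ≡⟨ cong (2 ^ u *_) (trans (^-*-assoc 2 y 4) (cong (2 ^_) (*-comm y 4))) ⟩
  2 ^ u * 2 ^ (4 * y)                       ≡⟨ ^-distribˡ-+-* 2 u (4 * y) ⟨
  2 ^ (u + 4 * y)                           ∎
  where
  open ≤-Reasoning
  regroup : ∀ u x y → u * x * suc (u + 4 * y) ≡ x * (u * (u + suc (4 * y)))
  regroup = solve-∀
  regroup₂ : ∀ x a → 2 * x + x * a ≡ x * (2 + a)
  regroup₂ = solve-∀
  regroup₃ : ∀ ν → 2 * (ν * ν) + 2 * ν * (2 * ν + ν) ≡ 8 * (ν * ν)
  regroup₃ = solve-∀
  regroup₄ : ∀ c y → 8 * (c * (y + y) * (c * (y + y))) ≡ 32 * (c * c) * (y * y)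
  regroup₄ = solve-∀
  regroup₅ : ∀ c → 32 * (c * c) + 4 * (c * c) ≡ 6 * c * (6 * c)
  regroup₅ = solve-∀
  regroup₆ : ∀ y → y * y * (y * y) ≡ y * (y * (y * (y * 1)))
  regroup₆ = solve-∀
  1≤ν : 1 ≤ ν
  1≤ν = ≤-trans (s≤s z≤n) 4y<ν
  1≤y : 1 ≤ y
  1≤y = ≤-trans (≤-trans (>-nonZero⁻¹ c) (m≤n*m c 6)) 6c≤y
  ν≤2cy : ν ≤ c * (y + y)
  ν≤2cy = ≤-trans ν≤ (*-monoʳ-≤ c (+-monoˡ-≤ y 1≤y))
  -- All quantities are bounded by multiples of `ν ≤ 2cy`, so the sum is at most `32 c² y²`;
  -- rounding 32 up to 36 turns this into `(6c)² y²`, where `6c ≤ y`.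
  bound : 2 + u * (u + suc (4 * y)) ≤ y ^ 4
  bound = begin
    2 + u * (u + suc (4 * y))                 ≤⟨ +-mono-≤ (*-monoʳ-≤ 2 (*-mono-≤ 1≤ν 1≤ν)) (*-mono-≤ u≤2ν (+-mono-≤ u≤2ν 4y<ν)) ⟩
    2 * (ν * ν) + 2 * ν * (2 * ν + ν)         ≡⟨ regroup₃ ν ⟩
    8 * (ν * ν)                               ≤⟨ *-monoʳ-≤ 8 (*-mono-≤ ν≤2cy ν≤2cy) ⟩
    8 * (c * (y + y) * (c * (y + y)))         ≡⟨ regroup₄ c y ⟩
    32 * (c * c) * (y * y)                    ≤⟨ *-monoˡ-≤ (y * y) (m≤m+n (32 * (c * c)) (4 * (c * c))) ⟩
    (32 * (c * c) + 4 * (c * c)) * (y * y)    ≡⟨ cong (_* (y * y)) (regroup₅ c) ⟩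
    6 * c * (6 * c) * (y * y)                 ≤⟨ *-monoˡ-≤ (y * y) (*-mono-≤ 6c≤y 6c≤y) ⟩
    y * y * (y * y)                           ≡⟨ regroup₆ y ⟩
    y ^ 4                                     ∎

-- Here `ν` is the binary logarithm of `n`, rounded down, `h = 2 ^ b`, and `τ` is the slack in the
-- size of the host graph. Since `R J′` is nearly `n`, the main terms leave `ν κ n`. What remains,
-- `rest`, comes from the connectors, the recorded chunk ends, the last block and `τ`.
exponent-bound : ∀ K .{{_ : NonZero K}} {κ g R B J′ τ b ν n} → let d = suc κ in
  B ≡ g + R → J′ * B ≤ n → n < suc J′ * B → ν ≤ d * b →
  4 * K * (g + 2 * d) ≤ B → 4 * K * (B + 2 * d + 1) ≤ n → 8 * K * (d * τ) ≤ ν →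
  d * ((ν + τ) * (n + (suc J′ + suc J′))) ≤ d * (b * R * J′) + ν * (κ * n + d * (n ℕ./ K))
exponent-bound K {κ} {g} {R} {B} {J′} {τ} {b} {ν} {n} refl J′B≤n n<JB ν≤db big-B big-n big-ν = begin
  d * ((ν + τ) * (n + (suc J′ + suc J′)))
    ≡⟨ expand κ ν τ n J′ ⟩
  ν * (κ * n) + ν * n + (ν * (2 * d * J′ + 2 * d) + d * τ * (n + (suc J′ + suc J′)))
    ≤⟨ +-monoˡ-≤ _ (+-monoʳ-≤ (ν * (κ * n)) (*-monoʳ-≤ ν n≤)) ⟩
  ν * (κ * n) + ν * (R * J′ + (g * J′ + B)) + (ν * (2 * d * J′ + 2 * d) + d * τ * (n + (suc J′ + suc J′)))
    ≡⟨ collect κ ν τ n J′ R g B ⟩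
  ν * R * J′ + (ν * (κ * n) + rest)
    ≤⟨ +-mono-≤ (*-monoˡ-≤ J′ (*-monoˡ-≤ R ν≤db)) (+-monoʳ-≤ (ν * (κ * n)) (≤-trans rest≤ (*-monoʳ-≤ ν (m≤n*m (n ℕ./ K) d)))) ⟩
  d * b * R * J′ + (ν * (κ * n) + ν * (d * (n ℕ./ K)))
    ≡⟨ cong₂ _+_ (assoc d b R J′) (sym (*-distribˡ-+ ν (κ * n) (d * (n ℕ./ K)))) ⟩
  d * (b * R * J′) + ν * (κ * n + d * (n ℕ./ K)) ∎
  where
  open ≤-Reasoning
  d rest S : ℕ
  d = suc κ
  S = n + (suc J′ + suc J′)
  rest = ν * ((g + 2 * d) * J′ + (B + 2 * d)) + d * τ * S

  expand : ∀ κ ν τ n J → suc κ * ((ν + τ) * (n + (suc J + suc J))) ≡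
    ν * (κ * n) + ν * n + (ν * (2 * suc κ * J + 2 * suc κ) + suc κ * τ * (n + (suc J + suc J)))
  expand = solve-∀
  collect : ∀ κ ν τ n J R g B →
    ν * (κ * n) + ν * (R * J + (g * J + B)) + (ν * (2 * suc κ * J + 2 * suc κ) + suc κ * τ * (n + (suc J + suc J)))
    ≡ ν * R * J + (ν * (κ * n) + (ν * ((g + 2 * suc κ) * J + (B + 2 * suc κ)) + suc κ * τ * (n + (suc J + suc J))))
  collect = solve-∀
  assoc : ∀ d b R J → d * b * R * J ≡ d * (b * R * J)
  assoc = solve-∀
  split : ∀ g R J → suc J * (g + R) ≡ R * J + (g * J + (g + R))
  split = solve-∀

  n≤ : n ≤ R * J′ + (g * J′ + B)
  n≤ = ≤-trans (<⇒≤ n<JB) (≤-reflexive (split g R J′))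

  n<K+ : n ≤ K * (n ℕ./ K) + K
  n<K+ = ≤-trans (<⇒≤ (n<[1+n/B]*B n K)) (≤-reflexive (trans (+-comm K _) (cong (_+ K) (*-comm (n ℕ./ K) K))))

  few-blocks : 4 * K * ((g + 2 * d) * J′) ≤ n
  few-blocks = begin
    4 * K * ((g + 2 * d) * J′)  ≡⟨ *-assoc (4 * K) (g + 2 * d) J′ ⟨
    4 * K * (g + 2 * d) * J′    ≤⟨ *-monoˡ-≤ J′ big-B ⟩
    B * J′                      ≡⟨ *-comm B J′ ⟩
    J′ * B                      ≤⟨ J′B≤n ⟩
    n                           ∎

  S≤2n : S ≤ 2 * n
  S≤2n = begin
    n + (suc J′ + suc J′)                        ≡⟨ cong (λ x → n + x) (double J′) ⟩
    n + (2 * J′ + 2)                             ≤⟨ +-monoʳ-≤ n (*-cancelˡ-≤ 2 2[2J+2]≤) ⟩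
    n + n                                        ≡⟨ cong (λ x → n + x) (+-identityʳ n) ⟨
    2 * n                                        ∎
    where
    double : ∀ J → suc J + suc J ≡ 2 * J + 2
    double = solve-∀
    double′ : ∀ J → 2 * (2 * J + 2) ≡ 4 * J + 4 * 1
    double′ = solve-∀
    4≤4K : 4 ≤ 4 * K
    4≤4K = *-monoʳ-≤ 4 (>-nonZero⁻¹ K)
    1≤g+2d : 1 ≤ g + 2 * d
    1≤g+2d = ≤-trans (s≤s z≤n) (m≤n+m (2 * d) g)
    2[2J+2]≤ : 2 * (2 * J′ + 2) ≤ 2 * n
    2[2J+2]≤ = begin
      2 * (2 * J′ + 2)                                      ≡⟨ double′ J′ ⟩
      4 * J′ + 4 * 1                                        ≤⟨ +-mono-≤ (*-mono-≤ 4≤4K (m≤n*m J′ (g + 2 * d) {{>-nonZero 1≤g+2d}}))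
                                                                         (*-mono-≤ 4≤4K (m≤n+m 1 (B + 2 * d))) ⟩
      4 * K * ((g + 2 * d) * J′) + 4 * K * (B + 2 * d + 1)  ≤⟨ +-mono-≤ few-blocks big-n ⟩
      n + n                                                 ≡⟨ cong (λ x → n + x) (+-identityʳ n) ⟨
      2 * n                                                 ∎

  rest≤ : rest ≤ ν * (n ℕ./ K)
  -- After multiplication by `4 * K`, each of the three size hypotheses bounds one part by `ν * n`.
  -- The extra `4 * K * ν` on both sides absorbs the rounding in `n / K`.
  rest≤ = *-cancelˡ-≤ (4 * K) {{m*n≢0 4 K}} (+-cancelʳ-≤ (4 * K * ν) _ _ (begin
    4 * K * rest + 4 * K * ν
      ≡⟨ spread K ν ((g + 2 * d) * J′) (B + 2 * d) (d * τ) S ⟩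
    ν * (4 * K * ((g + 2 * d) * J′)) + ν * (4 * K * (B + 2 * d + 1)) + 4 * K * (d * τ) * S
      ≤⟨ +-mono-≤ (+-mono-≤ (*-monoʳ-≤ ν few-blocks) (*-monoʳ-≤ ν big-n)) (*-monoʳ-≤ (4 * K * (d * τ)) S≤2n) ⟩
    ν * n + ν * n + 4 * K * (d * τ) * (2 * n)
      ≡⟨ cong (λ x → ν * n + ν * n + x) (eight K (d * τ) n) ⟩
    ν * n + ν * n + 8 * K * (d * τ) * n
      ≤⟨ +-monoʳ-≤ (ν * n + ν * n) (*-monoˡ-≤ n big-ν) ⟩
    ν * n + ν * n + ν * n
      ≤⟨ m≤m+n _ (ν * n) ⟩
    ν * n + ν * n + ν * n + ν * n
      ≡⟨ four (ν * n) ⟩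
    4 * (ν * n)
      ≤⟨ *-monoʳ-≤ 4 (*-monoʳ-≤ ν n<K+) ⟩
    4 * (ν * (K * (n ℕ./ K) + K))
      ≡⟨ final K ν (n ℕ./ K) ⟩
    4 * K * (ν * (n ℕ./ K)) + 4 * K * ν ∎))
    where
    spread : ∀ K ν x y z S → 4 * K * (ν * (x + y) + z * S) + 4 * K * ν ≡ ν * (4 * K * x) + ν * (4 * K * (y + 1)) + 4 * K * z * S
    spread = solve-∀
    eight : ∀ K z n → 4 * K * z * (2 * n) ≡ 8 * K * z * n
    eight = solve-∀
    four : ∀ x → x + x + x + x ≡ 4 * x
    four = solve-∀
    final : ∀ K ν q → 4 * (ν * (K * q + K)) ≡ 4 * K * (ν * q) + 4 * K * ν
    final = solve-∀

-- Choice of the parameters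

AvoidedBy : ∀ {m κ} → Graph m → (ℕ → ℕ → Vec ℕ κ) → Set
AvoidedBy G f = ∀ {p} (p-prime : Prime p) R′ h (Rh≤p : suc R′ * h ≤ p) → 2 < p →
  ¬ Layered.Contains {R′} {h} (T p-prime f R′ h Rh≤p) (T-involutive p-prime f R′ h Rh≤p) G

module _ {m κ} (G : Graph m) (branching : Branching G) (f : ℕ → ℕ → Vec ℕ (suc κ)) (avoided : AvoidedBy G f) where

  private
    d g : ℕ
    d = suc (suc κ)
    g = suc m

  family-count : ∀ {p} (p-prime : Prime p) → 2 < p → ∀ R′ h → suc R′ * h ≤ p → 1 ≤ h → ∀ J′ n →
    J′ * suc R′ + h ≤ h * p ^ suc κ → J′ * (g + suc R′) ≤ n → n ≤ suc J′ * (g + suc R′) →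
    ∀ {k} → Family n G k →
    let X = h * p ^ suc κ in
    k * (h ^ suc R′) ^ J′ ≤ (suc J′ * g + suc R′ * X) ^ n * (X ^ suc J′ * X ^ suc J′)
  family-count {p} p-prime 2<p R′ h Rh≤p 1≤h J′ n room J′B≤n n≤JB {k} family =
    subst (λ q → k * q ^ J′ ≤ (suc J′ * g + suc R′ * X) ^ n * (X ^ suc J′ * X ^ suc J′)) 1+Q′≡Q
      (count G branching (avoided p-prime R′ h Rh≤p 2<p) {J′} {n} {k} room′ J′B≤n n≤JB family {pred (h ^ suc R′)} (sym 1+Q′≡Q))
    where
    open Layered {R′} {h} {p ^ suc κ} (T p-prime f R′ h Rh≤p) (T-involutive p-prime f R′ h Rh≤p)
    open ≤-Reasoning
    X : ℕ
    X = h * p ^ suc κ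
    h^R≢0 : NonZero (h ^ suc R′)
    h^R≢0 = m^n≢0 h (suc R′) {{>-nonZero 1≤h}}
    1+Q′≡Q : suc (pred (h ^ suc R′)) ≡ h ^ suc R′
    1+Q′≡Q = suc-pred (h ^ suc R′) {{h^R≢0}}
    regroup₁ : ∀ J R h x → J * (R * x) + h * x ≡ (J * R + h) * x
    regroup₁ = solve-∀
    regroup₂ : ∀ h M x → h * M * x ≡ h * x * M
    regroup₂ = solve-∀
    room′ : J′ * (suc R′ * h ^ R′) + h ^ suc R′ ≤ h ^ suc R′ * p ^ suc κ
    room′ = begin
      J′ * (suc R′ * h ^ R′) + h * h ^ R′  ≡⟨ regroup₁ J′ (suc R′) h (h ^ R′) ⟩
      (J′ * suc R′ + h) * h ^ R′           ≤⟨ *-monoˡ-≤ (h ^ R′) room ⟩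
      h * p ^ suc κ * h ^ R′               ≡⟨ regroup₂ h (p ^ suc κ) (h ^ R′) ⟩
      h ^ suc R′ * p ^ suc κ               ∎

  eventual-bound : ∀ K .{{_ : NonZero K}} → ∃[ n₀ ] ∀ n → n₀ ≤ n → ∀ {k} → Family n G k →
                   k ^ d ≤ n ^ (suc κ * n + d * (n ℕ./ K))
  eventual-bound K = 2 ^ ν₀ , bound
    where
    ρ R R′ B c e ν₀ : ℕ
    -- Since `ρ < 2 ^ ρ = R`, the cost `g + 2 * d` of a connector and its recorded ends is at most
    -- the fraction `1 / 4K` of a block.
    ρ  = 4 * K * (g + 2 * d)
    R  = 2 ^ ρ
    R′ = pred R
    B  = g + R
    -- With `y = ν / c`, the summand `4 * y` of `τ`, due to the uncertain size of the prime,
    -- contributes `c * y ≤ ν` to `big-ν`; `e` is the part of `τ` without `y`.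
    c  = 64 * K * (d * d)
    e  = d * (ρ + 2) + 3
    -- The summands serve, in order, `6 * c ≤ y`, `big-ν`, `big-n` and `u ≤ 2 * ν`.
    ν₀ = 6 * c * c + (16 * K * (d * e) + 4 * K * (B + 2 * d + 1) + ρ + 1)

    instance
      R≢0 : NonZero R
      R≢0 = m^n≢0 2 ρ
      c≢0 : NonZero c
      c≢0 = m*n≢0 (64 * K) (d * d) {{m*n≢0 64 K}}

    1+R′≡R : suc R′ ≡ R
    1+R′≡R = suc-pred R

    bound : ∀ n → 2 ^ ν₀ ≤ n → ∀ {k} → Family n G k → k ^ d ≤ n ^ (suc κ * n + d * (n ℕ./ K))
    bound n 2^ν₀≤n {k} family with log₂ n {{>-nonZero (≤-trans (m^n>0 2 ν₀) 2^ν₀≤n)}}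
    ... | ν , 2^ν≤n , n<2^1+ν = begin
        k ^ d                     ≤⟨ 2^-quotient k d {b * R * J′} {(ν + τ) * (n + (suc J′ + suc J′))} {ν * A} count₂ exponents ⟩
        2 ^ (ν * A)               ≡⟨ ^-*-assoc 2 ν A ⟨
        (2 ^ ν) ^ A               ≤⟨ ^-monoˡ-≤ A 2^ν≤n ⟩
        n ^ A                     ∎
      where
      open ≤-Reasoning
      ν₀≤ν : ν₀ ≤ ν
      ν₀≤ν = ≤-pred (2^-cancel-< {ν₀} {suc ν} (≤-<-trans 2^ν₀≤n n<2^1+ν))

      A b u y J′ τ : ℕ
      A  = suc κ * n + d * (n ℕ./ K)
      -- Rounding up gives `ν < d * b`, so `h ^ d = 2 ^ (d * b)` exceeds `n`, by a factor of at most
      -- `2 ^ d`. The prime is taken above `2 ^ u = R * h` to give every layer its own colours.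
      b  = suc (ν ℕ./ d)
      u  = b + ρ
      y  = ν ℕ./ c
      J′ = n ℕ./ B
      τ  = d * (ρ + 2 + 4 * y) + 3

      6cc≤ν : 6 * c * c ≤ ν
      6cc≤ν = ≤-trans (m≤m+n (6 * c * c) _) ν₀≤ν
      tail≤ν : 16 * K * (d * e) + 4 * K * (B + 2 * d + 1) + ρ + 1 ≤ ν
      tail≤ν = ≤-trans (m≤n+m _ (6 * c * c)) ν₀≤ν
      16Kde+≤ν : 16 * K * (d * e) + 4 * K * (B + 2 * d + 1) + ρ ≤ ν
      16Kde+≤ν = ≤-trans (m≤m+n _ 1) tail≤ν

      6c≤y : 6 * c ≤ y
      6c≤y = ≤-trans (≤-reflexive (sym (m*n/n≡m (6 * c) c))) (/-mono-≤ 6cc≤ν (≤-refl {c}))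

      ν≤c[1+y] : ν ≤ c * suc y
      ν≤c[1+y] = ≤-trans (<⇒≤ (n<[1+n/B]*B ν c)) (≤-reflexive (*-comm (suc y) c))

      cy≤ν : c * y ≤ ν
      cy≤ν = ≤-trans (≤-reflexive (*-comm c y)) (m/n*n≤m ν c)

      d[ν/d]≤ν : d * (ν ℕ./ d) ≤ ν
      d[ν/d]≤ν = ≤-trans (≤-reflexive (*-comm d (ν ℕ./ d))) (m/n*n≤m ν d)

      ν<db : ν < d * b
      ν<db = ≤-trans (n<[1+n/B]*B ν d) (≤-reflexive (*-comm b d))

      4y<ν : suc (4 * y) ≤ ν
      4y<ν = begin
        suc (4 * y)  ≤⟨ +-monoˡ-≤ (4 * y) (≤-trans (≤-trans (>-nonZero⁻¹ c) (m≤n*m c 6)) 6c≤y) ⟩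
        5 * y        ≤⟨ *-monoˡ-≤ y (≤-trans (m≤m+n 5 59) (≤-trans (m≤m*n 64 K) (m≤m*n (64 * K) (d * d)))) ⟩
        c * y        ≤⟨ cy≤ν ⟩
        ν            ∎

      u≤2ν : u ≤ 2 * ν
      u≤2ν = begin
        suc (ν ℕ./ d) + ρ  ≤⟨ +-monoˡ-≤ ρ (s≤s (m/n≤m ν d)) ⟩
        suc ν + ρ        ≡⟨ +-suc ν ρ ⟨
        ν + suc ρ        ≡⟨ cong (λ x → ν + x) (+-comm 1 ρ) ⟩
        ν + (ρ + 1)      ≤⟨ +-monoʳ-≤ ν (≤-trans (+-monoˡ-≤ 1 (m≤n+m ρ _)) tail≤ν) ⟩
        ν + ν            ≡⟨ cong (λ x → ν + x) (+-identityʳ ν) ⟨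
        2 * ν            ∎

      prime-exists : ∃[ p ] Prime p × 2 ^ u < p × p < 2 ^ suc (u + 4 * y)
      prime-exists = prime-between u (u + 4 * y) (polynomial<exponential c y u ν 6c≤y ν≤c[1+y] u≤2ν 4y<ν)

      p h M X : ℕ
      p = proj₁ prime-exists
      h = 2 ^ b
      M = p ^ suc κ
      X = h * M

      p-prime : Prime p
      p-prime = proj₁ (proj₂ prime-exists)
      2^u<p : 2 ^ u < p
      2^u<p = proj₁ (proj₂ (proj₂ prime-exists))
      p<2^ : p < 2 ^ suc (u + 4 * y)
      p<2^ = proj₂ (proj₂ (proj₂ prime-exists))

      2<p : 2 < p
      2<p = ≤-<-trans (^-monoʳ-≤ 2 {1} {u} (s≤s z≤n)) 2^u<p

      Rh≤p : suc R′ * h ≤ p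
      Rh≤p = begin
        suc R′ * h     ≡⟨ cong (_* h) 1+R′≡R ⟩
        2 ^ ρ * 2 ^ b  ≡⟨ ^-distribˡ-+-* 2 ρ b ⟨
        2 ^ (ρ + b)    ≡⟨ cong (2 ^_) (+-comm ρ b) ⟩
        2 ^ u          ≤⟨ <⇒≤ 2^u<p ⟩
        p              ∎

      J′B≤n : J′ * B ≤ n
      J′B≤n = m/n*n≤m n B
      n<JB : n < suc J′ * B
      n<JB = n<[1+n/B]*B n B
      big-n : 4 * K * (B + 2 * d + 1) ≤ n
      big-n = begin
        4 * K * (B + 2 * d + 1)  ≤⟨ m≤n+m _ (16 * K * (d * e)) ⟩
        _                        ≤⟨ m≤m+n _ ρ ⟩
        _                        ≤⟨ 16Kde+≤ν ⟩
        ν                        ≤⟨ <⇒≤ (m<2^m ν) ⟩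
        2 ^ ν                    ≤⟨ 2^ν≤n ⟩
        n                        ∎
      B≤n : B ≤ n
      B≤n = ≤-trans (≤-trans (m≤m+n B (2 * d)) (m≤m+n _ 1)) (≤-trans (m≤n*m _ (4 * K) {{m*n≢0 4 K}}) big-n)

      -- Both summands are at most `2 ^ (d * b)`; the factor 2 for their sum is covered by `ρ ≥ 1`
      -- in `2 ^ (b + ρ) < p`.
      room : J′ * suc R′ + h ≤ h * M
      room = begin
        J′ * suc R′ + h                  ≤⟨ +-mono-≤ (≤-trans (*-monoʳ-≤ J′ (≤-trans (≤-reflexive 1+R′≡R) (m≤n+m R g))) J′B≤n)
                                                      (^-monoʳ-≤ 2 (m≤n*m b d)) ⟩
        n + 2 ^ (d * b)                  ≤⟨ +-monoˡ-≤ (2 ^ (d * b)) (≤-trans (<⇒≤ n<2^1+ν) (^-monoʳ-≤ 2 ν<db)) ⟩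
        2 ^ (d * b) + 2 ^ (d * b)        ≡⟨ cong (λ x → 2 ^ (d * b) + x) (+-identityʳ _) ⟨
        2 ^ suc (d * b)                  ≤⟨ ^-monoʳ-≤ 2 1+db≤ ⟩
        2 ^ (b + u * suc κ)              ≡⟨ ^-distribˡ-+-* 2 b (u * suc κ) ⟩
        2 ^ b * 2 ^ (u * suc κ)          ≡⟨ cong (2 ^ b *_) (^-*-assoc 2 u (suc κ)) ⟨
        2 ^ b * (2 ^ u) ^ suc κ          ≤⟨ *-monoʳ-≤ (2 ^ b) (^-monoˡ-≤ (suc κ) (<⇒≤ 2^u<p)) ⟩
        h * M                            ∎
        where
        regroup : ∀ b ρ κ → b + (b + ρ) * suc κ ≡ ρ * suc κ + suc (suc κ) * b
        regroup = solve-∀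
        1≤ρ : 1 ≤ ρ
        1≤ρ = >-nonZero⁻¹ ρ {{m*n≢0 (4 * K) (g + 2 * d) {{m*n≢0 4 K}}}}
        1+db≤ : suc (d * b) ≤ b + u * suc κ
        1+db≤ = ≤-trans (+-monoˡ-≤ (d * b) (≤-trans 1≤ρ (m≤m*n ρ (suc κ)))) (≤-reflexive (sym (regroup b ρ κ)))

      sites≤ : R * X ≤ 2 ^ (ν + d * (ρ + 2 + 4 * y))
      sites≤ = begin
        R * (h * M)                            ≡⟨ *-assoc R h M ⟨
        R * h * M                              ≤⟨ *-monoˡ-≤ M (subst (λ r → r * h ≤ p) 1+R′≡R Rh≤p) ⟩
        p ^ d                                  ≤⟨ ^-monoˡ-≤ d (<⇒≤ p<2^) ⟩
        (2 ^ suc (u + 4 * y)) ^ d              ≡⟨ ^-*-assoc 2 (suc (u + 4 * y)) d ⟩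
        2 ^ (suc (u + 4 * y) * d)              ≡⟨ cong (2 ^_) (regroup (ν ℕ./ d) ρ y d) ⟩
        2 ^ (d * (ν ℕ./ d) + d * (ρ + 2 + 4 * y)) ≤⟨ ^-monoʳ-≤ 2 (+-monoˡ-≤ (d * (ρ + 2 + 4 * y)) d[ν/d]≤ν) ⟩
        2 ^ (ν + d * (ρ + 2 + 4 * y))          ∎
        where
        regroup : ∀ q ρ y d → suc (suc q + ρ + 4 * y) * d ≡ d * q + d * (ρ + 2 + 4 * y)
        regroup = solve-∀

      N≤ : suc J′ * g + R * X ≤ 2 ^ (ν + τ)
      N≤ = begin
        suc J′ * g + R * X                     ≤⟨ +-mono-≤ connectors≤ (≤-trans sites≤ (^-monoʳ-≤ 2 (+-monoʳ-≤ ν (m≤m+n t 2)))) ⟩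
        2 ^ (ν + (t + 2)) + 2 ^ (ν + (t + 2))  ≡⟨ cong (λ x → 2 ^ (ν + (t + 2)) + x) (+-identityʳ _) ⟨
        2 ^ suc (ν + (t + 2))                  ≡⟨ cong (2 ^_) (regroup ν t) ⟩
        2 ^ (ν + τ)                            ∎
        where
        t : ℕ
        t = d * (ρ + 2 + 4 * y)
        regroup : ∀ ν t → suc (ν + (t + 2)) ≡ ν + (t + 3)
        regroup = solve-∀
        connectors≤ : suc J′ * g ≤ 2 ^ (ν + (t + 2))
        connectors≤ = begin
          suc J′ * g               ≤⟨ *-monoʳ-≤ (suc J′) (m≤m+n g R) ⟩
          B + J′ * B               ≤⟨ +-mono-≤ B≤n J′B≤n ⟩
          n + n                    ≤⟨ +-mono-≤ (<⇒≤ n<2^1+ν) (<⇒≤ n<2^1+ν) ⟩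
          2 ^ suc ν + 2 ^ suc ν    ≡⟨ cong (λ x → 2 ^ suc ν + x) (+-identityʳ _) ⟨
          2 ^ suc (suc ν)          ≤⟨ ^-monoʳ-≤ 2 (≤-trans (≤-reflexive (+-comm 2 ν)) (+-monoʳ-≤ ν (m≤n+m 2 t))) ⟩
          2 ^ (ν + (t + 2))        ∎

      X≤ : X ≤ 2 ^ (ν + τ)
      X≤ = ≤-trans (m≤n*m X R) (≤-trans (m≤n+m (R * X) (suc J′ * g)) N≤)

      count₁ : k * (h ^ R) ^ J′ ≤ (suc J′ * g + R * X) ^ n * (X ^ suc J′ * X ^ suc J′)
      count₁ = subst (λ r → k * (h ^ r) ^ J′ ≤ (suc J′ * g + r * X) ^ n * (X ^ suc J′ * X ^ suc J′)) 1+R′≡R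
        (family-count p-prime 2<p R′ h Rh≤p (m^n>0 2 b) J′ n room
          (subst (λ r → J′ * (g + r) ≤ n) (sym 1+R′≡R) J′B≤n)
          (subst (λ r → n ≤ suc J′ * (g + r)) (sym 1+R′≡R) (<⇒≤ n<JB)) family)

      count₂ : k * 2 ^ (b * R * J′) ≤ 2 ^ ((ν + τ) * (n + (suc J′ + suc J′)))
      count₂ = begin
        k * 2 ^ (b * R * J′)
          ≡⟨ cong (k *_) (trans (cong (_^ J′) (^-*-assoc 2 b R)) (^-*-assoc 2 (b * R) J′)) ⟨
        k * (h ^ R) ^ J′
          ≤⟨ count₁ ⟩
        (suc J′ * g + R * X) ^ n * (X ^ suc J′ * X ^ suc J′)
          ≤⟨ *-mono-≤ (^-monoˡ-≤ n N≤) (*-mono-≤ (^-monoˡ-≤ (suc J′) X≤) (^-monoˡ-≤ (suc J′) X≤)) ⟩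
        Λ ^ n * (Λ ^ suc J′ * Λ ^ suc J′)
          ≡⟨ trans (cong (Λ ^ n *_) (sym (^-distribˡ-+-* Λ (suc J′) (suc J′)))) (sym (^-distribˡ-+-* Λ n (suc J′ + suc J′))) ⟩
        Λ ^ (n + (suc J′ + suc J′))
          ≡⟨ ^-*-assoc 2 (ν + τ) _ ⟩
        2 ^ ((ν + τ) * (n + (suc J′ + suc J′))) ∎
        where
        Λ : ℕ
        Λ = 2 ^ (ν + τ)

      big-ν : 8 * K * (d * τ) ≤ ν
      big-ν = *-cancelˡ-≤ 2 (begin
        2 * (8 * K * (d * τ))              ≡⟨ regroup K d ρ y ⟩
        16 * K * (d * e) + c * y           ≤⟨ +-mono-≤ (≤-trans (≤-trans (m≤m+n _ _) (m≤m+n _ ρ)) 16Kde+≤ν) cy≤ν ⟩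
        ν + ν                              ≡⟨ cong (λ x → ν + x) (+-identityʳ ν) ⟨
        2 * ν                              ∎)
        where
        regroup : ∀ K d ρ y → 2 * (8 * K * (d * (d * (ρ + 2 + 4 * y) + 3))) ≡
                  16 * K * (d * (d * (ρ + 2) + 3)) + 64 * K * (d * d) * y
        regroup = solve-∀

      exponents : d * ((ν + τ) * (n + (suc J′ + suc J′))) ≤ d * (b * R * J′) + ν * (suc κ * n + d * (n ℕ./ K))
      exponents = exponent-bound K {suc κ} {g} {R} {J′ = J′} {τ} {b} {ν} {n} refl J′B≤n n<JB (<⇒≤ ν<db)
        (≤-trans (<⇒≤ (m<2^m ρ)) (m≤n+m R g)) big-n big-ν

-- Rational exponents and the error term

firstBelow : ∀ {P : ℕ → Set} → Decidable P → ℕ → ℕ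
-- An exhausted search returns the bound itself, so that a witness `j ≤ b` suffices for the result
-- to satisfy `P`.
firstBelow P? zero    = zero
firstBelow P? (suc b) with P? zero
... | yes _ = zero
... | no  _ = suc (firstBelow (P? ∘ suc) b)

firstBelow-≤ : ∀ {P : ℕ → Set} (P? : Decidable P) b {j} → P j → firstBelow P? b ≤ j
firstBelow-≤ P? zero    Pj = z≤n
firstBelow-≤ P? (suc b) {j} Pj with P? zero | j
... | yes _  | _     = z≤n
... | no ¬P0 | zero  = contradiction Pj ¬P0
... | no _   | suc j = s≤s (firstBelow-≤ (P? ∘ suc) b Pj)

firstBelow-holds : ∀ {P : ℕ → Set} (P? : Decidable P) b {j} → j ≤ b → P j → P (firstBelow P? b)
firstBelow-holds P? zero    z≤n Pj = Pj
firstBelow-holds P? (suc b) {j} j≤b Pj with P? zero | j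
... | yes P0 | _     = P0
... | no ¬P0 | zero  = contradiction Pj ¬P0
... | no _   | suc j = firstBelow-holds (P? ∘ suc) b (≤-pred j≤b) Pj

-- `q` is in lowest terms while `A / (δ + 1)` need not be: both sides are raised to the power
-- `δ + 1` and the fractions cross-multiplied. A negative `q` cannot equal such a fraction.
power-bound : ∀ {x b A δ} (q : ℚ) → toℚᵘ q ℚᵘ.≃ mkℚᵘ (+ A) δ → x ^ suc δ ≤ b ^ A → x ≤[ b ^ q ]
power-bound {x} {b} {A} {δ} (mkℚ (+ num) den _) (*≡* eq) x^d≤b^A = ^-cancelʳ-≤ (suc δ) (begin
  (x ^ suc den) ^ suc δ    ≡⟨ ^-*-assoc x (suc den) (suc δ) ⟩
  x ^ (suc den * suc δ)    ≡⟨ cong (x ^_) (*-comm (suc den) (suc δ)) ⟩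
  x ^ (suc δ * suc den)    ≡⟨ ^-*-assoc x (suc δ) (suc den) ⟨
  (x ^ suc δ) ^ suc den    ≤⟨ ^-monoˡ-≤ (suc den) x^d≤b^A ⟩
  (b ^ A) ^ suc den        ≡⟨ ^-*-assoc b A (suc den) ⟩
  b ^ (A * suc den)        ≡⟨ cong (b ^_) (ℤ.+-injective (trans (ℤ.pos-* A (suc den)) (trans (sym eq) (sym (ℤ.pos-* num (suc δ)))))) ⟩
  b ^ (num * suc δ)        ≡⟨ ^-*-assoc b num (suc δ) ⟨
  (b ^ num) ^ suc δ        ∎)
  where open ≤-Reasoning
power-bound {A = A} (mkℚ -[1+ _ ] _ _) (*≡* eq) _ with A
... | zero  with () ← eq
... | suc _ with () ← eq

toℚᵘ-fromℕ : ∀ n → toℚᵘ (fromℕ n) ℚᵘ.≃ mkℚᵘ (+ n) 0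
toℚᵘ-fromℕ n = ℚ.toℚᵘ-fromℚᵘ (mkℚᵘ (+ n) 0)

toℚᵘ-exponent : ∀ a δ n j → toℚᵘ ((+ a / suc δ) ℚ.* fromℕ n ℚ.+ fromℕ j) ℚᵘ.≃ mkℚᵘ (+ (a * n + suc δ * j)) δ
toℚᵘ-exponent a δ n j = ℚᵘ.≃-trans (ℚ.toℚᵘ-homo-+ ((+ a / suc δ) ℚ.* fromℕ n) (fromℕ j)) (ℚᵘ.≃-trans
  (ℚᵘ.+-cong (ℚᵘ.≃-trans (ℚ.toℚᵘ-homo-* (+ a / suc δ) (fromℕ n)) (ℚᵘ.*-cong (ℚ.toℚᵘ-fromℚᵘ (mkℚᵘ (+ a) δ)) (toℚᵘ-fromℕ n)))
             (toℚᵘ-fromℕ j))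
  (*≡* (begin
    (+ a ℤ.* + n ℤ.* + 1 ℤ.+ + j ℤ.* (+ (suc δ * 1))) ℤ.* + suc δ
      ≡⟨ cong (λ x → (+ a ℤ.* + n ℤ.* + 1 ℤ.+ + j ℤ.* x) ℤ.* + suc δ) (cong +_ (*-identityʳ (suc δ))) ⟩
    (+ a ℤ.* + n ℤ.* + 1 ℤ.+ + j ℤ.* + suc δ) ℤ.* + suc δ
      ≡⟨ regroup (+ a) (+ n) (+ j) (+ suc δ) ⟩
    (+ a ℤ.* + n ℤ.+ + suc δ ℤ.* + j) ℤ.* + suc δ
      ≡⟨ cong (ℤ._* + suc δ) (cong₂ ℤ._+_ (sym (ℤ.pos-* a n)) (sym (ℤ.pos-* (suc δ) j))) ⟩
    + (a * n + suc δ * j) ℤ.* + suc δ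
      ≡⟨ cong (λ x → + (a * n + suc δ * j) ℤ.* + x) (sym (trans (*-identityʳ _) (*-identityʳ (suc δ)))) ⟩
    + (a * n + suc δ * j) ℤ.* + (suc δ * 1 * 1) ∎)))
  where
  open ≡-Reasoning
  regroup : ∀ a n j d → (a ℤ.* n ℤ.* + 1 ℤ.+ j ℤ.* d) ℤ.* d ≡ (a ℤ.* n ℤ.+ d ℤ.* j) ℤ.* d
  regroup = ℤ-solve-∀

sublinear⇒o[n] : ∀ (e : ℕ → ℕ) → (∀ K .{{_ : NonZero K}} → ∃[ N ] ∀ n → N ≤ n → e n ≤ n ℕ./ K) → (fromℕ ∘ e) ∈o[n]
-- `K` is the denominator of `ε`: as the numerator is at least 1, `n / K ≤ ε n`.
sublinear⇒o[n] e sublinear ε@(mkℚ (+ suc num) den _) _ with sublinear (suc den)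
... | N , small = N , λ n N≤n → ℚ.≤-trans (ℚ.≤-reflexive (ℚ.0≤p⇒∣p∣≡p (0≤fromℕ (e n))))
        (ℚ.toℚᵘ-cancel-≤ (ℚᵘ.≤-respˡ-≃ (ℚᵘ.≃-sym (toℚᵘ-fromℕ (e n)))
          (ℚᵘ.≤-respʳ-≃ (ℚᵘ.≃-sym (ℚᵘ.≃-trans (ℚ.toℚᵘ-homo-* ε (fromℕ n)) (ℚᵘ.*-congˡ {toℚᵘ ε} (toℚᵘ-fromℕ n))))
            (*≤* (bound n (small n N≤n))))))
  where
  0≤fromℕ : ∀ n → 0ℚ ℚ.≤ fromℕ n
  0≤fromℕ n = ℚ.nonNegative⁻¹ (fromℕ n) {{ℚ.normalize-nonNeg n 1}}
  open ℤ.≤-Reasoning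
  bound : ∀ n → e n ≤ n ℕ./ suc den → + e n ℤ.* + (suc den * 1) ℤ.≤ + suc num ℤ.* + n ℤ.* + 1
  bound n e≤ = begin
    + e n ℤ.* + (suc den * 1)          ≡⟨ cong (λ x → + e n ℤ.* + x) (*-identityʳ (suc den)) ⟩
    + e n ℤ.* + suc den                ≡⟨ ℤ.pos-* (e n) (suc den) ⟨
    + (e n * suc den)                  ≤⟨ ℤ.+≤+ (≤-trans (*-monoˡ-≤ (suc den) e≤) (≤-trans (m/n*n≤m n (suc den)) (m≤n*m n (suc num)))) ⟩
    + (suc num * n)                    ≡⟨ ℤ.pos-* (suc num) n ⟩
    + suc num ℤ.* + n                  ≡⟨ ℤ.*-identityʳ _ ⟨
    + suc num ℤ.* + n ℤ.* + 1          ∎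
sublinear⇒o[n] e sublinear ε@(mkℚ (+ zero) _ _) 0<ε with () ← ℚ.positive 0<ε
sublinear⇒o[n] e sublinear ε@(mkℚ -[1+ _ ] _ _) 0<ε with () ← ℚ.positive 0<ε

-- The bounds for the various `K` are merged into one error term: `e n` is the least `j` that works
-- at `n`, hence eventually at most `n / K` for every `K`. The case `K = 1` provides a witness
-- within the search range `n`.
eventual⇒≤n^ : ∀ (a : ℕ → ℕ) κ δ →
  (∀ K .{{_ : NonZero K}} → ∃[ N ] ∀ n → N ≤ n → a n ^ suc δ ≤ n ^ (κ * n + suc δ * (n ℕ./ K))) →
  a ≤n^[ + κ / suc δ n+o[n]]
eventual⇒≤n^ a κ δ eventual = fromℕ ∘ e , sublinear⇒o[n] e sublinear , N₁ , λ n N₁≤n →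
    power-bound _ (toℚᵘ-exponent κ δ n (e n))
      (firstBelow-holds (good? n) n (m/n≤m n 1) (proj₂ (eventual 1) n N₁≤n))
  where
  Good : ℕ → ℕ → Set
  Good n j = a n ^ suc δ ≤ n ^ (κ * n + suc δ * j)
  good? : ∀ n → Decidable (Good n)
  good? n j = _ ≤? _
  e : ℕ → ℕ
  e n = firstBelow (good? n) n
  N₁ : ℕ
  N₁ = proj₁ (eventual 1)
  sublinear : ∀ K .{{_ : NonZero K}} → ∃[ N ] ∀ n → N ≤ n → e n ≤ n ℕ./ K
  sublinear K = proj₁ (eventual K) , λ n N≤n → firstBelow-≤ (good? n) n (proj₂ (eventual K) n N≤n)

H-bound : ∀ {m κ} (G : Graph m) → Branching G → (f : ℕ → ℕ → Vec ℕ (suc κ)) → AvoidedBy G f →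
          (λ n → H n G) ≤n^[ + suc κ / suc (suc κ) n+o[n]]
H-bound {κ = κ} G branching f avoided = eventual⇒≤n^ (λ n → H n G) (suc κ) (suc κ) λ K →
  let N , bound = eventual-bound G branching f avoided K
  in  N , λ n N≤n → bound n N≤n (proj₁ (H-isMaximum n G))

theorem2 : ((λ n → H n (C 6)) ≤n^[ + 2 / 3 n+o[n]])
    × ((λ n → H n (C 8)) ≤n^[ + 4 / 5 n+o[n]])
    × ((λ n → H n (C 10)) ≤n^[ + 4 / 5 n+o[n]])
theorem2 =
    H-bound (C 6)  branching₆  f₆  (λ p-prime R′ h Rh≤p _ → no-C₆ p-prime R′ h Rh≤p)
  , H-bound (C 8)  branching₈  f₈  no-C₈
  , H-bound (C 10) branching₁₀ f₁₀ (λ p-prime R′ h Rh≤p _ → no-C₁₀ p-prime R′ h Rh≤p)
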